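{- Let $G=(V,E)$ be a finite $2$-edge-connected directed graph (loops and multiple edges allowed) and let $u \in V$. Then there exist functions $f_2 : E \to \mathbb{Z}_2$ and $f_3 : E \to \mathbb{Z}_3$ such that $f_2$ is a $\mathbb{Z}_2$-flow, $f_3$ is a $\mathbb{Z}_3$-flow, for every edge $e \in E$ we have $(f_2(e), f_3(e)) \neq (0,0)$ (i.e. $f_2 \times f_3$ is a nowhere-zero $\mathbb{Z}_2 \times \mathbb{Z}_3$-flow), and $f_2(e) = 0$ for every edge $e$ incident to $u$.
   Context: For a directed graph $G=(V,E)$ and an additively written abelian group $A$, a function $f : E \to A$ is an $A$-flow if for every vertex $v \in V$, $\sum_{e \in \delta^+(v)} f(e) = \sum_{e \in \delta^-(v)} f(e)$, where $\delta^+(v)$ (resp. $\delta^-(v)$) is the set of edges whose initial (resp. terminal) vertex is $v$. It is nowhere-zero if $0 \notin f(E)$. The map $f_2 \times f_3 : E \to \mathbb{Z}_2 \times \mathbb{Z}_3$ is $e \mapsto (f_2(e), f_3(e))$; the support $\mathrm{supp}(f_2)$ is the set of edges $e$ with $f_2(e) \neq 0$, and $\delta(u)$ denotes the set of edges incident to $u$. $2$-edge-connectedness refers to the underlying undirected graph. -}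

module Defs where

open import Data.Nat using (ℕ; suc; NonZero)
open import Data.Nat.DivMod using (_mod_)
open import Data.Fin using (Fin; toℕ; zero)
open import Data.List using (List; []; _∷_; map; filter)
open import Data.Nat.ListAction using (sum)
open import Data.List.Base using (allFin)
open import Data.Product using (_×_; Σ; _,_)
open import Data.Sum using (_⊎_)
open import Relation.Binary.PropositionalEquality using (_≡_; _≢_)
open import Relation.Nullary using (¬_)
open import Relation.Unary using (Pred)
open import Data.Fin using (_≟_)
open import Level using (0ℓ)

record Digraph : Set where
  field
    nV   : ℕ
    nE   : ℕ
    tail : Fin nE → Fin nV
    head : Fin nE → Fin nV
open Digraph public

data WalkAvoiding (G : Digraph) (X : Fin (nE G) → Set) : Fin (nV G) → Fin (nV G) → Set where
  here    : ∀ {x} → WalkAvoiding G X x x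
  forward : ∀ {y} (e : Fin (nE G)) → ¬ X e →
            WalkAvoiding G X (head G e) y → WalkAvoiding G X (tail G e) y
  backward : ∀ {y} (e : Fin (nE G)) → ¬ X e →
            WalkAvoiding G X (tail G e) y → WalkAvoiding G X (head G e) y

Connected : Digraph → Set
Connected G = ∀ x y → WalkAvoiding G (λ _ → Data.Empty.⊥) x y
  where import Data.Empty

TwoEdgeConnected : Digraph → Set
TwoEdgeConnected G =
  Connected G × (∀ (e : Fin (nE G)) → ∀ x y → WalkAvoiding G (λ e' → e' ≡ e) x y)

sumℤ : (k : ℕ) .{{_ : NonZero k}} → List (Fin k) → Fin k
sumℤ k xs = sum (map toℕ xs) mod k

δ⁺ : (G : Digraph) → Fin (nV G) → List (Fin (nE G))
δ⁺ G v = filter (λ e → tail G e ≟ v) (allFin (nE G))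

δ⁻ : (G : Digraph) → Fin (nV G) → List (Fin (nE G))
δ⁻ G v = filter (λ e → head G e ≟ v) (allFin (nE G))

IsFlow : (G : Digraph) (k : ℕ) .{{_ : NonZero k}} → (Fin (nE G) → Fin k) → Set
IsFlow G k f = ∀ v → sumℤ k (map f (δ⁺ G v)) ≡ sumℤ k (map f (δ⁻ G v))

Incident : (G : Digraph) → Fin (nE G) → Fin (nV G) → Set
Incident G e u = (tail G e ≡ u) ⊎ (head G e ≡ u)

{-# OPTIONS --safe #-}
module Submission where

-- By induction on a set K of vertices other than u: everything outside K counts as already
-- contracted into u, so only conservation at the vertices of K is required, and f₂ must vanish on
-- every edge with an end outside K.  Choose a minimal nonempty S ⊆ K with at most one edge to
-- K ∖ S; by minimality S is 2-edge-connected.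
--
-- If S has a single edge d = vp to the outside of K, contract v.  Conservation at v determines
-- f₃ d, and {d, e} is a 2-edge cut, where e joins S to K ∖ S.  As f₂ d = 0, the cut forces
-- f₂ e = 0, hence f₃ e ≠ 0, hence f₃ d ≠ 0.
--
-- Otherwise S has two edges d, d′ to the outside of K.  A closed trail in S passes through their
-- ends in S; contract it.  Then f₂ is made nonzero on the trail, so f₃ may be changed freely there
-- to move all excess to one vertex, and that excess is absorbed by d and d′, whose values can be
-- kept nonzero because ℤ₃ has three elements.

open import Defs
open import Algebra.Bundles using (AbelianGroup)
open import Algebra.Structures using (IsAbelianGroup)
import Algebra.Properties.AbelianGroup as AbelianGroupProperties
import Algebra.Properties.CommutativeMonoid.Sum as CommutativeMonoidSum
import Algebra.Properties.CommutativeSemigroup as CommutativeSemigroupProperties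
open import Data.Empty using (⊥-elim)
open import Data.Bool using (Bool; true; false; if_then_else_)
open import Data.Nat as ℕ using (ℕ; _≤_; z≤n; s≤s)
import Data.Nat.Properties as ℕ
import Data.Nat.ListAction as ListAction
open import Data.Nat.DivMod using (_mod_; _%_; %-distribˡ-+; m<n⇒m%n≡m; m%n<n)
open import Data.List as List using (_∷_)
open import Data.Fin using (Fin; zero; suc; toℕ; _≟_)
open import Data.Fin.Properties using (all?; any?; toℕ-injective; toℕ-fromℕ<; toℕ<n)
open import Data.Fin.Subset
  using (Subset; _∈_; _∉_; _⊆_; _⊂_; _⊃_; _∪_; _∩_; ∁; ⁅_⁆; ⊤; Nonempty)
open import Data.Fin.Subset.Induction using (Acc; acc; ⊂-wellFounded; ⊃-wellFounded)
open import Data.Fin.Subset.Properties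
open import Data.Product using (_×_; Σ; ∃; ∃₂; _,_; proj₁; proj₂)
open import Data.Sum as Sum using (_⊎_; inj₁; inj₂)
open import Function using (_∘_; case_of_)
open import Level using (0ℓ)
open import Relation.Binary.PropositionalEquality
  using (_≡_; _≢_; refl; sym; trans; cong; cong₂; subst; isEquivalence; module ≡-Reasoning)
open import Relation.Nullary using (¬_; Dec; yes; no; does; contradiction)
open import Relation.Nullary.Decidable using (_×-dec_; _⊎-dec_; _→-dec_; ¬?; dec-true; dec-false;
                                              decidable-stable; from-yes)

-- Difference and insertion for subsets of a finite set

module _ {n : ℕ} where

  _∖_ : Subset n → Subset n → Subset n
  p ∖ q = p ∩ ∁ q

  ∈∖⁺ : ∀ {x} p q → x ∈ p → x ∉ q → x ∈ p ∖ q
  ∈∖⁺ p q x∈p x∉q = x∈p∩q⁺ {p = p} {q = ∁ q} (x∈p , x∉p⇒x∈∁p x∉q)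

  ∈∖⁻ : ∀ {x} p q → x ∈ p ∖ q → x ∈ p × x ∉ q
  ∈∖⁻ p q x∈ with x∈p∩q⁻ p (∁ q) x∈
  ... | x∈p , x∈∁q = x∈p , x∈∁p⇒x∉p x∈∁q

  ∖-⊂ : ∀ {x} p q → x ∈ p → x ∈ q → p ∖ q ⊂ p
  ∖-⊂ {x} p q x∈p x∈q = p∩q⊆p p (∁ q) , x , x∈p , λ x∈ → proj₂ (∈∖⁻ p q x∈) x∈q

  ⊂-insert : ∀ {x} (p : Subset n) → x ∉ p → p ⊂ p ∪ ⁅ x ⁆
  ⊂-insert {x} p x∉p = p⊆p∪q ⁅ x ⁆ , x , q⊆p∪q p ⁅ x ⁆ (x∈⁅x⁆ x) , x∉p

  ∈-insert⁻ : ∀ {x y} (p : Subset n) → y ∈ p ∪ ⁅ x ⁆ → y ∈ p ⊎ y ≡ x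
  ∈-insert⁻ {x} p y∈ with x∈p∪q⁻ p ⁅ x ⁆ y∈
  ... | inj₁ y∈p = inj₁ y∈p
  ... | inj₂ y∈x = inj₂ (x∈⁅y⁆⇒x≡y x y∈x)

-- Recursion along inclusion of subsets

module _ {n : ℕ} where

  -- Increasing chains of subsets of a finite set end, so a step that either delivers `R` or
  -- enlarges `T` must at last deliver `R`. The closure arguments `ear` and `link` are run this way,
  -- with `P` as their invariant.
  grow : (P : Subset n → Set) {R : Set} →
         (∀ T → P T → R ⊎ ∃ λ T′ → T ⊂ T′ × P T′) → ∀ T → P T → R
  grow P {R} step T pT = go T pT (⊃-wellFounded T)
    where
    go : ∀ T → P T → Acc _⊃_ T → R
    go T pT (acc rec) with step T pT
    ... | inj₁ r              = r
    ... | inj₂ (T′ , ⊂ , pT′) = go T′ pT′ (rec ⊂)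

  minimal : {P : Subset n → Set} → (∀ S → Dec (P S)) → ∀ S → P S →
            ∃ λ M → P M × (∀ T → T ⊂ M → ¬ P T)
  minimal {P} P? S pS = go S pS (⊂-wellFounded S)
    where
    go : ∀ S → P S → Acc _⊂_ S → ∃ λ M → P M × (∀ T → T ⊂ M → ¬ P T)
    go S pS (acc rec) with anySubset? (λ T → (T ⊂? S) ×-dec P? T)
    ... | yes (T , T⊂S , pT) = go T pT (rec T⊂S)
    ... | no ¬smaller        = S , pS , λ T T⊂S pT → ¬smaller (T , T⊂S , pT)

-- Predicates with at most one or at least two witnesses

module _ {n : ℕ} where

  AtMostOne Two : (Fin n → Set) → Set
  AtMostOne F = ∀ i j → F i → F j → i ≡ j
  Two F = ∃₂ λ i j → F i × F j × i ≢ j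

  atMostOne? : ∀ {F : Fin n → Set} → (∀ i → Dec (F i)) → Dec (AtMostOne F)
  atMostOne? F? = all? λ i → all? λ j → F? i →-dec (F? j →-dec (i ≟ j))

  atMostOne-or-two : ∀ {F : Fin n → Set} → (∀ i → Dec (F i)) → AtMostOne F ⊎ Two F
  atMostOne-or-two F? with any? (λ i → any? (λ j → F? i ×-dec (F? j ×-dec ¬? (i ≟ j))))
  ... | yes two = inj₂ two
  ... | no ¬two = inj₁ λ i j Fi Fj →
    decidable-stable (i ≟ j) λ i≢j → ¬two (i , j , Fi , Fj , i≢j)

  two-avoid : ∀ {F : Fin n → Set} → Two F → ∀ k → ∃ λ i → F i × i ≢ k
  two-avoid (i , j , Fi , Fj , i≢j) k with i ≟ k
  ... | no i≢k   = i , Fi , i≢k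
  ... | yes refl = j , Fj , i≢j ∘ sym

-- The underlying undirected graph: cuts and walks

module Graph (G : Digraph) where

  V E : Set
  V = Fin (nV G)
  E = Fin (nE G)

  -- Orientation is forgotten, but the alternative chosen still records whether `e` is traversed
  -- along or against its direction; `signed` reads the sign from it.
  Joins : E → V → V → Set
  Joins e x y = (tail G e ≡ x × head G e ≡ y) ⊎ (tail G e ≡ y × head G e ≡ x)

  Joins-sym : ∀ {e x y} → Joins e x y → Joins e y x
  Joins-sym (inj₁ p) = inj₂ p
  Joins-sym (inj₂ p) = inj₁ p

  Joins-unique : ∀ {e x y x′ y′} → Joins e x y → Joins e x′ y′ →
                 (x ≡ x′ × y ≡ y′) ⊎ (x ≡ y′ × y ≡ x′)
  Joins-unique (inj₁ (refl , refl)) (inj₁ (refl , refl)) = inj₁ (refl , refl)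
  Joins-unique (inj₁ (refl , refl)) (inj₂ (refl , refl)) = inj₂ (refl , refl)
  Joins-unique (inj₂ (refl , refl)) (inj₁ (refl , refl)) = inj₂ (refl , refl)
  Joins-unique (inj₂ (refl , refl)) (inj₂ (refl , refl)) = inj₁ (refl , refl)

  Inside : Subset (nV G) → E → Set
  Inside K e = tail G e ∈ K × head G e ∈ K

  Joins-Inside : ∀ {e x y K} → Joins e x y → x ∈ K → y ∈ K → Inside K e
  Joins-Inside (inj₁ (refl , refl)) x∈K y∈K = x∈K , y∈K
  Joins-Inside (inj₂ (refl , refl)) x∈K y∈K = y∈K , x∈K

  Inside-Joins : ∀ {e x y K} → Joins e x y → Inside K e → x ∈ K × y ∈ K
  Inside-Joins (inj₁ (refl , refl)) i = i
  Inside-Joins (inj₂ (refl , refl)) (p , q) = q , p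

  Between : Subset (nV G) → Subset (nV G) → E → Set
  Between P Q e = (tail G e ∈ P × head G e ∈ Q) ⊎ (head G e ∈ P × tail G e ∈ Q)

  between? : ∀ P Q e → Dec (Between P Q e)
  between? P Q e =
    ((tail G e ∈? P) ×-dec (head G e ∈? Q)) ⊎-dec ((head G e ∈? P) ×-dec (tail G e ∈? Q))

  between⁺ : ∀ {e x y P Q} → Joins e x y → x ∈ P → y ∈ Q → Between P Q e
  between⁺ (inj₁ (refl , refl)) x∈P y∈Q = inj₁ (x∈P , y∈Q)
  between⁺ (inj₂ (refl , refl)) x∈P y∈Q = inj₂ (x∈P , y∈Q)

  between⁻ : ∀ {e P Q} → Between P Q e → ∃₂ λ x y → Joins e x y × x ∈ P × y ∈ Q
  between⁻ (inj₁ (p , q)) = _ , _ , inj₁ (refl , refl) , p , q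
  between⁻ (inj₂ (p , q)) = _ , _ , inj₂ (refl , refl) , p , q

  data Walk (S : Subset (nV G)) : V → V → Set where
    nil  : ∀ {x} → x ∈ S → Walk S x x
    cons : ∀ {x y z} e → x ∈ S → Joins e x y → Walk S y z → Walk S x z

  vertices : ∀ {S x y} → Walk S x y → Subset (nV G)
  vertices (nil {x} _)        = ⁅ x ⁆
  vertices (cons {x} _ _ _ w) = ⁅ x ⁆ ∪ vertices w

  -- Multiplicities add under concatenation. Being a trail is the bound `occ w e′ ≤ 1`, and
  -- edge-disjointness of two trails is the same bound on a sum.
  occ : ∀ {S x y} → Walk S x y → E → ℕ
  occ (nil _)        e′ = 0
  occ (cons e _ _ w) e′ = (if does (e ≟ e′) then 1 else 0) ℕ.+ occ w e′

  start∈ : ∀ {S x y} (w : Walk S x y) → x ∈ vertices w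
  start∈ (nil {x} _)        = x∈⁅x⁆ x
  start∈ (cons {x} _ _ _ w) = p⊆p∪q (vertices w) (x∈⁅x⁆ x)

  end∈ : ∀ {S x y} (w : Walk S x y) → y ∈ vertices w
  end∈ (nil {x} _)        = x∈⁅x⁆ x
  end∈ (cons {x} _ _ _ w) = q⊆p∪q ⁅ x ⁆ (vertices w) (end∈ w)

  vertices⊆ : ∀ {S x y} (w : Walk S x y) → vertices w ⊆ S
  vertices⊆ {S} (nil {x} x∈S) v∈ = subst (_∈ S) (sym (x∈⁅y⁆⇒x≡y x v∈)) x∈S
  vertices⊆ {S} (cons {x} _ x∈S _ w) v∈ with x∈p∪q⁻ ⁅ x ⁆ (vertices w) v∈
  ... | inj₁ v∈x = subst (_∈ S) (sym (x∈⁅y⁆⇒x≡y x v∈x)) x∈S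
  ... | inj₂ v∈w = vertices⊆ w v∈w

  occ-Inside : ∀ {S x y} (w : Walk S x y) e → occ w e ≢ 0 → Inside (vertices w) e
  occ-Inside (nil _) e e∈ = contradiction refl e∈
  occ-Inside (cons {x} e′ _ j w) e e∈ with e′ ≟ e
  ... | yes refl = Joins-Inside j (p⊆p∪q (vertices w) (x∈⁅x⁆ x))
                                  (q⊆p∪q ⁅ x ⁆ (vertices w) (start∈ w))
  ... | no _ with occ-Inside w e e∈
  ...   | p , q = q⊆p∪q ⁅ x ⁆ (vertices w) p , q⊆p∪q ⁅ x ⁆ (vertices w) q

-- Chains with coefficients in an abelian group and their boundary

module Chains {A : Set} {_+_ : A → A → A} {0# : A} { -_ : A → A}
  (isAbelianGroup : IsAbelianGroup _≡_ _+_ 0# -_) where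

  𝔸 : AbelianGroup 0ℓ 0ℓ
  𝔸 = record { isAbelianGroup = isAbelianGroup }

  open AbelianGroup 𝔸 public using ()
    renaming (identityˡ to +-identityˡ; identityʳ to +-identityʳ; inverseˡ to +-inverseˡ;
              inverseʳ to +-inverseʳ; assoc to +-assoc; comm to +-comm)
  open AbelianGroup 𝔸 using (commutativeMonoid; commutativeSemigroup)
  open AbelianGroupProperties 𝔸
    using (⁻¹-∙-comm; inverseʳ-unique; x∙y⁻¹≈ε⇒x≈y; xyx⁻¹≈y)
  open AbelianGroupProperties 𝔸 public using ()
    renaming (ε⁻¹≈ε to neg-zero; ⁻¹-involutive to neg-involutive)
  open CommutativeMonoidSum commutativeMonoid
    using (sum; sum-cong-≗; sum-replicate-zero; ∑-distrib-+; ∑-comm)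
  open CommutativeSemigroupProperties commutativeSemigroup using (interchange)
  open ≡-Reasoning

  sum-zero : ∀ {n} (g : Fin n → A) → (∀ i → g i ≡ 0#) → sum g ≡ 0#
  sum-zero {n} g g≡0 = trans (sum-cong-≗ g≡0) (sum-replicate-zero n)

  sum-unique : ∀ {n} (g : Fin n → A) x → (∀ i → i ≢ x → g i ≡ 0#) → sum g ≡ g x
  sum-unique g zero    h = trans (cong (g zero +_) (sum-zero (g ∘ suc) (λ i → h (suc i) λ ())))
                                 (+-identityʳ _)
  sum-unique g (suc x) h = trans (cong₂ _+_ (h zero λ ())
                                   (sum-unique (g ∘ suc) x λ i i≢x → h (suc i) λ { refl → i≢x refl }))
                                 (+-identityˡ _)

  sum-neg : ∀ {n} (g : Fin n → A) → sum (λ i → - g i) ≡ - sum g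
  sum-neg {ℕ.zero}  g = sym neg-zero
  sum-neg {ℕ.suc n} g = trans (cong ((- g zero) +_) (sum-neg (g ∘ suc))) (⁻¹-∙-comm _ _)

  sum-diff : ∀ {n} (f g : Fin n → A) → sum (λ i → f i + (- g i)) ≡ sum f + (- sum g)
  sum-diff f g = trans (∑-distrib-+ f (λ i → - g i)) (cong (sum f +_) (sum-neg g))

  diff-interchange : ∀ a b c d → (a + b) + (- (c + d)) ≡ (a + (- c)) + (b + (- d))
  diff-interchange a b c d =
    trans (cong ((a + b) +_) (sym (⁻¹-∙-comm c d))) (interchange a b (- c) (- d))

  infix 25 _▸_
  -- A coefficient multiplied by an indicator. Sums over the edges at a vertex, or over a vertex
  -- set, become sums over a full `Fin n`, whose order can be exchanged.
  _▸_ : Bool → A → A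
  b ▸ a = if b then a else 0#

  ▸-+ : ∀ b x y → b ▸ (x + y) ≡ b ▸ x + b ▸ y
  ▸-+ true  x y = refl
  ▸-+ false x y = sym (+-identityˡ 0#)

  ▸-neg : ∀ b x → b ▸ (- x) ≡ - (b ▸ x)
  ▸-neg true  x = refl
  ▸-neg false x = sym neg-zero

  ▸-sum : ∀ {n} b (g : Fin n → A) → b ▸ sum g ≡ sum (λ i → b ▸ g i)
  ▸-sum true  g = refl
  ▸-sum {n} false g = sym (sum-zero {n} (λ _ → 0#) (λ _ → refl))

  ▸-zero : ∀ b → b ▸ 0# ≡ 0#
  ▸-zero true  = refl
  ▸-zero false = refl

  ▸-true : ∀ {P : Set} (P? : Dec P) {a} → P → does P? ▸ a ≡ a
  ▸-true P? {a} p = cong (_▸ a) (dec-true P? p)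

  ▸-false : ∀ {P : Set} (P? : Dec P) {a} → ¬ P → does P? ▸ a ≡ 0#
  ▸-false P? {a} ¬p = cong (_▸ a) (dec-false P? ¬p)

  module _ (G : Digraph) where
    open Graph G

    -- `∂ f v` is the excess at `v`; a loop at `v` enters both sums and cancels.
    inflow outflow ∂ : (E → A) → V → A
    inflow  f v = sum λ e → does (head G e ≟ v) ▸ f e
    outflow f v = sum λ e → does (tail G e ≟ v) ▸ f e
    ∂ f v = inflow f v + (- outflow f v)

    _⊕_ : (E → A) → (E → A) → (E → A)
    (f ⊕ g) e = f e + g e

    ∂-⊕ : ∀ f g v → ∂ (f ⊕ g) v ≡ ∂ f v + ∂ g v
    ∂-⊕ f g v = trans (cong₂ (λ a b → a + (- b)) (split head) (split tail))
                      (diff-interchange _ _ _ _)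
      where
      split : (end : ∀ G → Fin (nE G) → Fin (nV G)) →
              sum (λ e → does (end G e ≟ v) ▸ (f e + g e)) ≡
              sum (λ e → does (end G e ≟ v) ▸ f e) + sum (λ e → does (end G e ≟ v) ▸ g e)
      split end = trans (sum-cong-≗ λ e → ▸-+ (does (end G e ≟ v)) (f e) (g e)) (∑-distrib-+ {nE G} _ _)

    ∂-local : ∀ f g v → (∀ e → Incident G e v → f e ≡ g e) → ∂ f v ≡ ∂ g v
    ∂-local f g v f≡g = cong₂ (λ a b → a + (- b)) (same head λ p → f≡g _ (inj₂ p))
                                                  (same tail λ p → f≡g _ (inj₁ p))
      where
      same : (end : ∀ G → Fin (nE G) → Fin (nV G)) → (∀ {e} → end G e ≡ v → f e ≡ g e) →
             sum (λ e → does (end G e ≟ v) ▸ f e) ≡ sum (λ e → does (end G e ≟ v) ▸ g e)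
      same end h = sum-cong-≗ λ e → lem e (end G e ≟ v)
        where
        lem : ∀ e (d : Dec (end G e ≡ v)) → does d ▸ f e ≡ does d ▸ g e
        lem e (yes p) = h p
        lem e (no _)  = refl

    ∂-null : ∀ f v → (∀ e → Incident G e v → f e ≡ 0#) → ∂ f v ≡ 0#
    ∂-null f v f≡0 = trans (∂-local f (λ _ → 0#) v f≡0)
      (trans (cong₂ (λ a b → a + (- b)) (vanish head) (vanish tail))
             (+-inverseʳ 0#))
      where
      vanish : (end : ∀ G → Fin (nE G) → Fin (nV G)) → sum (λ e → does (end G e ≟ v) ▸ 0#) ≡ 0#
      vanish end = sum-zero (λ e → does (end G e ≟ v) ▸ 0#) λ e → ▸-zero (does (end G e ≟ v))

    signed : ∀ {e x y} → Joins e x y → A → A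
    signed (inj₁ _) a = a
    signed (inj₂ _) a = - a

    -- `signed j` is the identity or negation, so the equation can be solved for `a`: only one
    -- amount sent over an edge makes its value vanish.
    signed-unique : ∀ {e x y} (j : Joins e x y) b a → b + signed j a ≡ 0# → a ≡ signed j (- b)
    signed-unique (inj₁ _) b a eq = inverseʳ-unique b a eq
    signed-unique (inj₂ _) b a eq = sym (trans (neg-involutive b) (x∙y⁻¹≈ε⇒x≈y b a eq))

    single : E → A → E → A
    single e a e′ = does (e ≟ e′) ▸ a

    dart : ∀ {e x y} → Joins e x y → A → E → A
    dart {e} j a = single e (signed j a)

    dart-same : ∀ {e x y} (j : Joins e x y) a → dart j a e ≡ signed j a
    dart-same {e} j a = ▸-true (e ≟ e) refl

    dart-other : ∀ {e x y e′} (j : Joins e x y) a → e′ ≢ e → dart j a e′ ≡ 0#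
    dart-other {e} {e′ = e′} j a e′≢e = ▸-false (e ≟ e′) (e′≢e ∘ sym)

    point : V → A → V → A
    point x a v = does (x ≟ v) ▸ a

    point-same : ∀ x a → point x a x ≡ a
    point-same x a = ▸-true (x ≟ x) refl

    point-other : ∀ x a {v} → v ≢ x → point x a v ≡ 0#
    point-other x a {v} v≢x = ▸-false (x ≟ v) (v≢x ∘ sym)

    ∂-single : ∀ e a v → ∂ (single e a) v ≡ point (head G e) a v + (- point (tail G e) a v)
    ∂-single e a v = cong₂ (λ a b → a + (- b)) (only head) (only tail)
      where
      only : (end : ∀ G → Fin (nE G) → Fin (nV G)) →
             sum (λ e′ → does (end G e′ ≟ v) ▸ single e a e′) ≡ does (end G e ≟ v) ▸ a
      only end = trans
        (sum-unique _ e λ e′ e′≢e →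
          trans (cong (does (end G e′ ≟ v) ▸_) (▸-false (e ≟ e′) (e′≢e ∘ sym))) (▸-zero _))
        (cong (does (end G e ≟ v) ▸_) (▸-true (e ≟ e) refl))

    ∂-dart : ∀ {e x y} (j : Joins e x y) a v → ∂ (dart j a) v ≡ point y a v + (- point x a v)
    ∂-dart {e} (inj₁ (refl , refl)) a v = ∂-single e a v
    ∂-dart {e} {x} {y} (inj₂ (refl , refl)) a v = begin
      ∂ (single e (- a)) v                      ≡⟨ ∂-single e (- a) v ⟩
      point x (- a) v + (- point y (- a) v)     ≡⟨ cong₂ (λ a b → a + (- b)) (▸-neg _ a) (▸-neg _ a) ⟩
      (- point x a v) + (- (- point y a v))     ≡⟨ cong ((- point x a v) +_) (neg-involutive _) ⟩
      (- point x a v) + point y a v             ≡⟨ +-comm _ _ ⟩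
      point y a v + (- point x a v)             ∎

    chain : ∀ {S x y} → Walk S x y → A → E → A
    chain (nil _)        a = λ _ → 0#
    chain (cons _ _ j w) a = dart j a ⊕ chain w a

    diff-trans : ∀ a b c → (b + (- a)) + (c + (- b)) ≡ c + (- a)
    diff-trans a b c = begin
      (b + (- a)) + (c + (- b))   ≡⟨ interchange b (- a) c (- b) ⟩
      (b + c) + ((- a) + (- b))   ≡⟨ cong ((b + c) +_) (+-comm _ _) ⟩
      (b + c) + ((- b) + (- a))   ≡⟨ sym (+-assoc (b + c) (- b) (- a)) ⟩
      ((b + c) + (- b)) + (- a)   ≡⟨ cong (_+ (- a)) (xyx⁻¹≈y b c) ⟩
      c + (- a)                   ∎

    -- The boundaries of the darts telescope. In particular the chain of a closed walk is balanced
    -- everywhere, whatever its coefficient.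
    ∂-chain : ∀ {S x y} (w : Walk S x y) a v → ∂ (chain w a) v ≡ point y a v + (- point x a v)
    ∂-chain (nil {x} _) a v = trans (∂-null (λ _ → 0#) v (λ _ _ → refl)) (sym (+-inverseʳ (point x a v)))
    ∂-chain (cons {x} {y} {z} e _ j w) a v = begin
      ∂ (dart j a ⊕ chain w a) v
        ≡⟨ ∂-⊕ (dart j a) (chain w a) v ⟩
      ∂ (dart j a) v + ∂ (chain w a) v
        ≡⟨ cong₂ _+_ (∂-dart j a v) (∂-chain w a v) ⟩
      (point y a v + (- point x a v)) + (point z a v + (- point y a v))
        ≡⟨ diff-trans (point x a v) (point y a v) (point z a v) ⟩
      point z a v + (- point x a v) ∎

    point-arrives : ∀ {x y v} a → v ≢ x → point y a v + (- point x a v) ≡ point y a v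
    point-arrives {x} {y} {v} a v≢x =
      trans (cong (point y a v +_) (trans (cong -_ (point-other x a v≢x)) neg-zero)) (+-identityʳ _)

    ∂-dart-arrives : ∀ {e x y v} (j : Joins e x y) a → v ≢ x → ∂ (dart j a) v ≡ point y a v
    ∂-dart-arrives {y = y} j a v≢x = trans (∂-dart j a _) (point-arrives {y = y} a v≢x)

    ∂-chain-arrives : ∀ {S x y v} (w : Walk S x y) a → v ≢ x → ∂ (chain w a) v ≡ point y a v
    ∂-chain-arrives {y = y} w a v≢x = trans (∂-chain w a _) (point-arrives {y = y} a v≢x)

    chain-unused : ∀ {S x y} (w : Walk S x y) a e → occ w e ≡ 0 → chain w a e ≡ 0#
    chain-unused (nil _) a e e∉ = refl
    chain-unused (cons e′ _ j w) a e e∉ with e′ ≟ e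
    ... | no _ = trans (+-identityˡ _) (chain-unused w a e e∉)

    -- The one traversal contributes `a` up to sign, and every other dart of the walk vanishes at
    -- `e`.
    chain-once : ∀ {S x y} (w : Walk S x y) a e → occ w e ≡ 1 → chain w a e ≡ a ⊎ chain w a e ≡ - a
    chain-once (cons e′ _ j w) a e e∈ with e′ ≟ e
    ... | yes refl rewrite chain-unused w a e (ℕ.suc-injective e∈) with j
    ...   | inj₁ _ = inj₁ (+-identityʳ _)
    ...   | inj₂ _ = inj₂ (+-identityʳ _)
    chain-once (cons e′ _ j w) a e e∈ | no _ rewrite +-identityˡ (chain w a e) = chain-once w a e e∈

    -- Walking along w, the excess at each vertex is sent on over the next edge.
    push : ∀ {S x z} (w : Walk S x z) f → Σ (E → A) λ f′ →
      (∀ e → occ w e ≡ 0 → f′ e ≡ f e) ×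
      (∀ v → v ∈ vertices w → v ≢ z → ∂ f′ v ≡ 0#) ×
      (∀ v → v ∉ vertices w → ∂ f′ v ≡ ∂ f v)
    push (nil {x} _) f =
      f , (λ _ _ → refl) , (λ v v∈x v≢x → contradiction (x∈⁅y⁆⇒x≡y x v∈x) v≢x) , λ _ _ → refl
    push (cons {x} {y} {z} e x∈S j w) f =
      f′ , unchanged , balanced , away
      where
      f₁ : E → A
      f₁ = f ⊕ dart j (∂ f x)

      ∂f₁ : ∀ v → ∂ f₁ v ≡ ∂ f v + (point y (∂ f x) v + (- point x (∂ f x) v))
      ∂f₁ v = trans (∂-⊕ f (dart j (∂ f x)) v) (cong (∂ f v +_) (∂-dart j (∂ f x) v))

      rest : Σ (E → A) λ f′ →
        (∀ e → occ w e ≡ 0 → f′ e ≡ f₁ e) ×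
        (∀ v → v ∈ vertices w → v ≢ z → ∂ f′ v ≡ 0#) ×
        (∀ v → v ∉ vertices w → ∂ f′ v ≡ ∂ f₁ v)
      rest = push w f₁

      f′ : E → A
      f′ = proj₁ rest

      unchanged : ∀ e′ → occ (cons e x∈S j w) e′ ≡ 0 → f′ e′ ≡ f e′
      unchanged e′ e′∉ with e ≟ e′
      ... | no e≢e′ = trans (proj₁ (proj₂ rest) e′ e′∉)
                            (trans (cong (f e′ +_) (dart-other j _ (e≢e′ ∘ sym))) (+-identityʳ _))

      balanced : ∀ v → v ∈ ⁅ x ⁆ ∪ vertices w → v ≢ z → ∂ f′ v ≡ 0#
      balanced v v∈ v≢z with v ∈? vertices w | x∈p∪q⁻ ⁅ x ⁆ (vertices w) v∈
      -- A vertex met again later is settled by the later push; this dart has to settle `x` only if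
      -- `w` never returns to it.
      ... | yes v∈w | _        = proj₁ (proj₂ (proj₂ rest)) v v∈w v≢z
      ... | no v∉w  | inj₂ v∈w = contradiction v∈w v∉w
      ... | no v∉w  | inj₁ v∈x with x∈⁅y⁆⇒x≡y x v∈x
      ...   | refl = begin
        ∂ f′ x
          ≡⟨ proj₂ (proj₂ (proj₂ rest)) x v∉w ⟩
        ∂ f₁ x
          ≡⟨ ∂f₁ x ⟩
        ∂ f x + (point y (∂ f x) x + (- point x (∂ f x) x))
          ≡⟨ cong (∂ f x +_) (cong₂ (λ a b → a + (- b))
               (point-other y _ λ { refl → v∉w (start∈ w) }) (point-same x _)) ⟩
        ∂ f x + (0# + (- ∂ f x))
          ≡⟨ cong (∂ f x +_) (+-identityˡ _) ⟩
        ∂ f x + (- ∂ f x)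
          ≡⟨ +-inverseʳ _ ⟩
        0# ∎

      away : ∀ v → v ∉ ⁅ x ⁆ ∪ vertices w → ∂ f′ v ≡ ∂ f v
      away v v∉ = begin
        ∂ f′ v
          ≡⟨ proj₂ (proj₂ (proj₂ rest)) v (λ v∈w → v∉ (q⊆p∪q ⁅ x ⁆ (vertices w) v∈w)) ⟩
        ∂ f₁ v
          ≡⟨ ∂f₁ v ⟩
        ∂ f v + (point y (∂ f x) v + (- point x (∂ f x) v))
          ≡⟨ cong (∂ f v +_) (cong₂ (λ a b → a + (- b))
               (point-other y _ λ { refl → v∉ (q⊆p∪q ⁅ x ⁆ (vertices w) (start∈ w)) })
               (point-other x _ λ { refl → v∉ (p⊆p∪q (vertices w) (x∈⁅x⁆ x)) })) ⟩
        ∂ f v + (0# + (- 0#))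
          ≡⟨ cong (∂ f v +_) (+-inverseʳ 0#) ⟩
        ∂ f v + 0#
          ≡⟨ +-identityʳ _ ⟩
        ∂ f v ∎

    -- Total excess of a vertex set and flow across a cut

    flux : Subset (nV G) → (E → A) → E → A
    flux S f e = does (head G e ∈? S) ▸ f e + (- (does (tail G e ∈? S) ▸ f e))

    -- Double counting: after the sums are exchanged, each edge is counted once at its head and
    -- once, negatively, at its tail.
    ∂-sum : ∀ S f → sum (λ v → does (v ∈? S) ▸ ∂ f v) ≡ sum (flux S f)
    ∂-sum S f = begin
      sum (λ v → does (v ∈? S) ▸ ∂ f v)
        ≡⟨ sum-cong-≗ (λ v → trans (▸-+ (does (v ∈? S)) _ _)
             (cong (does (v ∈? S) ▸ inflow f v +_) (▸-neg (does (v ∈? S)) _))) ⟩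
      sum (λ v → does (v ∈? S) ▸ inflow f v + (- (does (v ∈? S) ▸ outflow f v)))
        ≡⟨ sum-diff (λ v → does (v ∈? S) ▸ inflow f v) (λ v → does (v ∈? S) ▸ outflow f v) ⟩
      sum (λ v → does (v ∈? S) ▸ inflow f v) + (- sum (λ v → does (v ∈? S) ▸ outflow f v))
        ≡⟨ cong₂ (λ a b → a + (- b)) (swap head) (swap tail) ⟩
      sum (λ e → does (head G e ∈? S) ▸ f e) + (- sum (λ e → does (tail G e ∈? S) ▸ f e))
        ≡⟨ sum-diff (λ e → does (head G e ∈? S) ▸ f e) (λ e → does (tail G e ∈? S) ▸ f e) ⟨
      sum (flux S f) ∎
      where
      swap : (end : ∀ G → Fin (nE G) → Fin (nV G)) →
             sum (λ v → does (v ∈? S) ▸ sum (λ e → does (end G e ≟ v) ▸ f e)) ≡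
             sum (λ e → does (end G e ∈? S) ▸ f e)
      swap end = begin
        sum (λ v → does (v ∈? S) ▸ sum (λ e → does (end G e ≟ v) ▸ f e))
          ≡⟨ sum-cong-≗ (λ v → ▸-sum (does (v ∈? S)) (λ e → does (end G e ≟ v) ▸ f e)) ⟩
        sum (λ v → sum (λ e → does (v ∈? S) ▸ (does (end G e ≟ v) ▸ f e)))
          ≡⟨ ∑-comm (λ v e → does (v ∈? S) ▸ (does (end G e ≟ v) ▸ f e)) ⟩
        sum (λ e → sum (λ v → does (v ∈? S) ▸ (does (end G e ≟ v) ▸ f e)))
          ≡⟨ sum-cong-≗ (λ e → trans
               (sum-unique (λ v → does (v ∈? S) ▸ (does (end G e ≟ v) ▸ f e)) (end G e)
                 λ v v≢ → trans (cong (does (v ∈? S) ▸_) (▸-false (end G e ≟ v) (v≢ ∘ sym)))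
                                (▸-zero (does (v ∈? S))))
               (cong (does (end G e ∈? S) ▸_) (▸-true (end G e ≟ end G e) refl))) ⟩
        sum (λ e → does (end G e ∈? S) ▸ f e) ∎

    flux-inert : ∀ S f e → ¬ Between S (∁ S) e → flux S f e ≡ 0#
    flux-inert S f e ¬cross with head G e ∈? S | tail G e ∈? S
    ... | yes _ | yes _ = +-inverseʳ (f e)
    ... | no  _ | no  _ = +-inverseʳ 0#
    ... | yes h | no  t = contradiction (inj₂ (h , x∉p⇒x∈∁p t)) ¬cross
    ... | no  h | yes t = contradiction (inj₁ (t , x∉p⇒x∈∁p h)) ¬cross

    flux-null : ∀ S f e → f e ≡ 0# → flux S f e ≡ 0#
    flux-null S f e f≡0 rewrite f≡0 =
      trans (cong₂ (λ a b → a + (- b)) (▸-zero (does (head G e ∈? S))) (▸-zero (does (tail G e ∈? S))))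
            (+-inverseʳ 0#)

    -- Exactly one end of a crossing edge lies in `S`, so its flux is `f e` up to sign.
    flux-cross : ∀ S f e → Between S (∁ S) e → flux S f e ≡ 0# → f e ≡ 0#
    flux-cross S f e cross eq with head G e ∈? S | tail G e ∈? S | cross
    ... | yes _ | no  _ | _ =
      trans (sym (+-identityʳ _)) (trans (cong (f e +_) (sym neg-zero)) eq)
    ... | no  _ | yes _ | _ = sym (x∙y⁻¹≈ε⇒x≈y 0# (f e) eq)
    ... | yes h | yes t | inj₁ (_ , h∉) = contradiction h (x∈∁p⇒x∉p h∉)
    ... | yes h | yes t | inj₂ (_ , t∉) = contradiction t (x∈∁p⇒x∉p t∉)
    ... | no  h | no  t | inj₁ (t∈ , _) = contradiction t∈ t
    ... | no  h | no  t | inj₂ (h∈ , _) = contradiction h∈ h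

    -- The excesses in `S` add up to zero, and only crossing edges contribute to that sum. If all of
    -- them but `e` carry zero, the flux of `e` is the whole sum.
    cut-rule : ∀ S f e → (∀ v → v ∈ S → ∂ f v ≡ 0#) → Between S (∁ S) e →
               (∀ e′ → e′ ≢ e → Between S (∁ S) e′ → f e′ ≡ 0#) → f e ≡ 0#
    cut-rule S f e ∂f≡0 cross others = flux-cross S f e cross (begin
      flux S f e                         ≡⟨ sum-unique (flux S f) e flux≡0 ⟨
      sum (flux S f)                     ≡⟨ ∂-sum S f ⟨
      sum (λ v → does (v ∈? S) ▸ ∂ f v)  ≡⟨ sum-zero (λ v → does (v ∈? S) ▸ ∂ f v) (λ v → inside v (v ∈? S)) ⟩
      0#                                 ∎)
      where
      inside : ∀ v (v∈? : Dec (v ∈ S)) → does v∈? ▸ ∂ f v ≡ 0#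
      inside v (yes v∈S) = ∂f≡0 v v∈S
      inside v (no _)    = refl

      flux≡0 : ∀ e′ → e′ ≢ e → flux S f e′ ≡ 0#
      flux≡0 e′ e′≢e with between? S (∁ S) e′
      ... | yes c = flux-null S f e′ (others e′ e′≢e c)
      ... | no ¬c = flux-inert S f e′ ¬c

    -- No edge leaves the set of all vertices, so the excesses sum to zero; `u` contributes the only
    -- term not already known to vanish.
    conservation : ∀ f u → (∀ v → v ≢ u → ∂ f v ≡ 0#) → ∀ v → ∂ f v ≡ 0#
    conservation f u ∂f≡0 v with v ≟ u
    ... | no v≢u   = ∂f≡0 v v≢u
    ... | yes refl = begin
        ∂ f u
          ≡⟨ ▸-true (u ∈? ⊤) ∈⊤ ⟨
        does (u ∈? ⊤) ▸ ∂ f u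
          ≡⟨ sum-unique (λ v → does (v ∈? ⊤) ▸ ∂ f v) u
               (λ v v≢u → trans (cong (does (v ∈? ⊤) ▸_) (∂f≡0 v v≢u)) (▸-zero (does (v ∈? ⊤)))) ⟨
        sum (λ v → does (v ∈? ⊤) ▸ ∂ f v)
          ≡⟨ ∂-sum ⊤ f ⟩
        sum (flux ⊤ f)
          ≡⟨ sum-zero (flux ⊤ f) (λ e → flux-inert ⊤ f e λ
               { (inj₁ (_ , h)) → x∈∁p⇒x∉p h ∈⊤ ; (inj₂ (_ , t)) → x∈∁p⇒x∉p t ∈⊤ }) ⟩
        0# ∎

-- Walks and trails: concatenation, reversal, splitting

module Trails (G : Digraph) where

  open Graph G

  _++_ : ∀ {S x y z} → Walk S x y → Walk S y z → Walk S x z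
  nil _          ++ w′ = w′
  cons e x∈S j w ++ w′ = cons e x∈S j (w ++ w′)

  occ-++ : ∀ {S x y z} (w : Walk S x y) (w′ : Walk S y z) e → occ (w ++ w′) e ≡ occ w e ℕ.+ occ w′ e
  occ-++ (nil _) w′ e = refl
  occ-++ (cons e′ _ _ w) w′ e =
    trans (cong ((if does (e′ ≟ e) then 1 else 0) ℕ.+_) (occ-++ w w′ e))
          (sym (ℕ.+-assoc (if does (e′ ≟ e) then 1 else 0) (occ w e) (occ w′ e)))

  reverse : ∀ {S x y} → Walk S x y → Walk S y x
  reverse (nil x∈S) = nil x∈S
  reverse (cons e x∈S j w) =
    reverse w ++ cons e (vertices⊆ w (start∈ w)) (Joins-sym j) (nil x∈S)

  occ-reverse : ∀ {S x y} (w : Walk S x y) e → occ (reverse w) e ≡ occ w e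
  occ-reverse (nil _) e = refl
  occ-reverse (cons e′ x∈S j w) e = begin
    occ (reverse w ++ cons e′ y∈S (Joins-sym j) (nil x∈S)) e
      ≡⟨ occ-++ (reverse w) (cons e′ y∈S (Joins-sym j) (nil x∈S)) e ⟩
    occ (reverse w) e ℕ.+ (b ℕ.+ 0)
      ≡⟨ cong₂ ℕ._+_ (occ-reverse w e) (ℕ.+-identityʳ b) ⟩
    occ w e ℕ.+ b
      ≡⟨ ℕ.+-comm (occ w e) b ⟩
    b ℕ.+ occ w e ∎
    where
    open ≡-Reasoning
    y∈S = vertices⊆ w (start∈ w)
    b = if does (e′ ≟ e) then 1 else 0

  weaken : ∀ {S T x y} → T ⊆ S → Walk T x y → Walk S x y
  weaken T⊆S (nil x∈T)        = nil (T⊆S x∈T)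
  weaken T⊆S (cons e x∈T j w) = cons e (T⊆S x∈T) j (weaken T⊆S w)

  vertices-weaken : ∀ {S T x y} (T⊆S : T ⊆ S) (w : Walk T x y) → vertices (weaken T⊆S w) ≡ vertices w
  vertices-weaken T⊆S (nil _)            = refl
  vertices-weaken T⊆S (cons {x} _ _ _ w) = cong (⁅ x ⁆ ∪_) (vertices-weaken T⊆S w)

  occ-weaken : ∀ {S T x y} (T⊆S : T ⊆ S) (w : Walk T x y) e → occ (weaken T⊆S w) e ≡ occ w e
  occ-weaken T⊆S (nil _) e = refl
  occ-weaken T⊆S (cons e′ _ _ w) e = cong ((if does (e′ ≟ e) then 1 else 0) ℕ.+_) (occ-weaken T⊆S w e)

  occ-outside : ∀ {S Q x y} (w : Walk S x y) e → vertices w ⊆ Q → ¬ Inside Q e → occ w e ≡ 0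
  occ-outside w e w⊆Q ¬inside with occ w e ℕ.≟ 0
  ... | yes e∉ = e∉
  ... | no  e∈ with occ-Inside w e e∈
  ...   | p , q = contradiction (w⊆Q p , w⊆Q q) ¬inside

  split : ∀ {S x y v} (w : Walk S x y) → v ∈ vertices w →
          ∃₂ λ (w₁ : Walk S x v) (w₂ : Walk S v y) → ∀ e → occ w e ≡ occ w₁ e ℕ.+ occ w₂ e
  split (nil {x} x∈S) v∈ with x∈⁅y⁆⇒x≡y x v∈
  ... | refl = nil x∈S , nil x∈S , λ _ → refl
  split (cons {x} e x∈S j w) v∈ with x∈p∪q⁻ ⁅ x ⁆ (vertices w) v∈
  ... | inj₁ v∈x with x∈⁅y⁆⇒x≡y x v∈x
  ...   | refl = nil x∈S , cons e x∈S j w , λ _ → refl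
  split (cons {x} e x∈S j w) v∈ | inj₂ v∈w with split w v∈w
  ... | w₁ , w₂ , eq = cons e x∈S j w₁ , w₂ , λ e′ →
    trans (cong ((if does (e ≟ e′) then 1 else 0) ℕ.+_) (eq e′))
          (sym (ℕ.+-assoc (if does (e ≟ e′) then 1 else 0) (occ w₁ e′) (occ w₂ e′)))

  -- Every edge of `w` has both ends in `T`, whereas `e` has the end `x` outside; so `e` is new.
  occ-cons≤1 : ∀ {S T x y z} e (x∈S : x ∈ S) (j : Joins e x y) (w : Walk S y z) →
               vertices w ⊆ T → x ∉ T → (∀ e′ → occ w e′ ≤ 1) → ∀ e′ → occ (cons e x∈S j w) e′ ≤ 1
  occ-cons≤1 e x∈S j w w⊆T x∉T w≤1 e′ with e ≟ e′
  ... | no _     = w≤1 e′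
  ... | yes refl rewrite occ-outside w e w⊆T (λ i → x∉T (proj₁ (Inside-Joins j i))) = s≤s z≤n

  -- The cut form of 2-edge-connectedness of the subgraph induced by `S`; a single vertex satisfies
  -- it vacuously.
  EdgeConnected₂ : Subset (nV G) → Set
  EdgeConnected₂ S = ∀ T → T ⊆ S → Nonempty T → Nonempty (S ∖ T) → Two (Between T (S ∖ T))

  -- Ears, and pairs of edge-disjoint trails

  module _ {S : Subset (nV G)} (S-conn : EdgeConnected₂ S) where

    -- An alternative to `e` for getting from `Q` to `y`. As none of its edges is inside `Q`, it
    -- shares no edge with a walk whose vertices all lie in `Q`.
    record Ear (Q : Subset (nV G)) (e : E) (y : V) : Set where
      field
        {foot}  : V
        foot∈   : foot ∈ Q
        walk    : Walk S foot y
        occ≤1   : ∀ e′ → occ walk e′ ≤ 1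
        avoids  : ∀ e′ → occ walk e′ ≢ 0 → e′ ≢ e
        outside : ∀ e′ → occ walk e′ ≢ 0 → ¬ Inside Q e′

    -- Two edges leave the set T of vertices known to reach y off Q, so one of them is not e:
    -- it either lands in Q or enlarges T.
    ear : ∀ Q e x y → x ∈ Q → x ∈ S → y ∈ S → y ∉ Q → Joins e x y → Ear Q e y
    ear Q e x y x∈Q x∈S y∈S y∉Q e-joins =
      grow Reaching step ⁅ y ⁆ (x∈⁅x⁆ y , y⊆S , y-off-Q , λ z∈ → start z∈)
      where
      Reaching : Subset (nV G) → Set
      Reaching T = y ∈ T × T ⊆ S × (∀ {z} → z ∈ T → z ∉ Q) ×
        (∀ {z} → z ∈ T → Σ (Walk T z y) λ w → ∀ e′ → occ w e′ ≤ 1)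

      y⊆S : ⁅ y ⁆ ⊆ S
      y⊆S z∈ = subst (_∈ S) (sym (x∈⁅y⁆⇒x≡y y z∈)) y∈S

      y-off-Q : ∀ {z} → z ∈ ⁅ y ⁆ → z ∉ Q
      y-off-Q z∈ z∈Q = y∉Q (subst (_∈ Q) (x∈⁅y⁆⇒x≡y y z∈) z∈Q)

      start : ∀ {z} → z ∈ ⁅ y ⁆ → Σ (Walk ⁅ y ⁆ z y) λ w → ∀ e′ → occ w e′ ≤ 1
      start z∈ with x∈⁅y⁆⇒x≡y y z∈
      ... | refl = nil z∈ , λ _ → z≤n

      step : ∀ T → Reaching T → Ear Q e y ⊎ ∃ λ T′ → T ⊂ T′ × Reaching T′
      step T (y∈T , T⊆S , T-off-Q , reach) with
        two-avoid (S-conn T T⊆S (y , y∈T) (x , ∈∖⁺ S T x∈S λ x∈T → T-off-Q x∈T x∈Q)) e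
      ... | a , a-cross , a≢e with between⁻ a-cross
      ... | z , z′ , j , z∈T , z′∈ with ∈∖⁻ S T z′∈ | reach z∈T | z′ ∈? Q
      ... | z′∈S , z′∉T | w , w≤1 | yes z′∈Q = inj₁ record
        { foot∈   = z′∈Q
        ; walk    = cons a z′∈S (Joins-sym j) w′
        ; occ≤1   = occ-cons≤1 a z′∈S (Joins-sym j) w′ w′⊆T z′∉T
                      (λ e′ → subst (_≤ 1) (sym (occ-weaken T⊆S w e′)) (w≤1 e′))
        ; avoids  = avoids
        ; outside = outside
        }
        where
        w′ : Walk S z y
        w′ = weaken T⊆S w

        in-T : ∀ e′ → occ w′ e′ ≢ 0 → Inside T e′
        in-T e′ e′∈ with occ-Inside w e′ (subst (_≢ 0) (occ-weaken T⊆S w e′) e′∈)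
        ... | p , q = vertices⊆ w p , vertices⊆ w q

        w′⊆T : vertices w′ ⊆ T
        w′⊆T = subst (_⊆ T) (sym (vertices-weaken T⊆S w)) (vertices⊆ w)

        avoids : ∀ e′ → occ (cons a z′∈S (Joins-sym j) w′) e′ ≢ 0 → e′ ≢ e
        avoids e′ e′∈ with a ≟ e′
        ... | yes refl = a≢e
        -- `e` has its end `x` in `Q`, whereas the rest of the walk stays in `T`, off `Q`.
        ... | no _     = λ { refl → T-off-Q (proj₁ (Inside-Joins e-joins (in-T e′ e′∈))) x∈Q }

        outside : ∀ e′ → occ (cons a z′∈S (Joins-sym j) w′) e′ ≢ 0 → ¬ Inside Q e′
        outside e′ e′∈ with a ≟ e′
        ... | yes refl = λ i → T-off-Q z∈T (proj₁ (Inside-Joins j i))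
        ... | no _     = λ i → T-off-Q (proj₁ (in-T e′ e′∈)) (proj₁ i)
      ... | z′∈S , z′∉T | w , w≤1 | no z′∉Q =
        inj₂ (T′ , ⊂-insert T z′∉T , T⊆T′ y∈T , T′⊆S , T′-off-Q , reach′)
        where
        T′ : Subset (nV G)
        T′ = T ∪ ⁅ z′ ⁆

        T⊆T′ : T ⊆ T′
        T⊆T′ = p⊆p∪q ⁅ z′ ⁆

        T′⊆S : T′ ⊆ S
        T′⊆S v∈ with ∈-insert⁻ T v∈
        ... | inj₁ v∈T  = T⊆S v∈T
        ... | inj₂ refl = z′∈S

        T′-off-Q : ∀ {v} → v ∈ T′ → v ∉ Q
        T′-off-Q v∈ with ∈-insert⁻ T v∈
        ... | inj₁ v∈T  = T-off-Q v∈T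
        ... | inj₂ refl = z′∉Q

        reach′ : ∀ {v} → v ∈ T′ → Σ (Walk T′ v y) λ w → ∀ e′ → occ w e′ ≤ 1
        reach′ v∈ with ∈-insert⁻ T v∈
        ... | inj₁ v∈T with reach v∈T
        ...   | u , u≤1 = weaken T⊆T′ u , λ e′ → subst (_≤ 1) (sym (occ-weaken T⊆T′ u e′)) (u≤1 e′)
        reach′ v∈ | inj₂ refl =
          cons a v∈ (Joins-sym j) (weaken T⊆T′ w) ,
          occ-cons≤1 a v∈ (Joins-sym j) (weaken T⊆T′ w)
            (subst (_⊆ T) (sym (vertices-weaken T⊆T′ w)) (vertices⊆ w)) z′∉T
            (λ e′ → subst (_≤ 1) (sym (occ-weaken T⊆T′ w e′)) (w≤1 e′))

    -- Bounding the sum says at once that both walks are trails and that they share no edge. Going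
    -- out by one and back by the other is a closed trail.
    record Link (x y : V) : Set where
      field
        walk₁ walk₂ : Walk S x y
        disjoint    : ∀ e → occ walk₁ e ℕ.+ occ walk₂ e ≤ 1

    open Link

    swap-link : ∀ {x y} → Link x y → Link x y
    swap-link l = record
      { walk₁    = walk₂ l
      ; walk₂    = walk₁ l
      ; disjoint = λ e → subst (_≤ 1) (ℕ.+-comm (occ (walk₁ l) e) (occ (walk₂ l) e)) (disjoint l e)
      }

    -- The part of walk₁ beyond v, reversed, brings walk₂ back to v.
    truncate-link : ∀ {x y v} (l : Link x y) → v ∈ vertices (walk₁ l) → Link x v
    truncate-link l v∈ with split (walk₁ l) v∈
    ... | u₁ , u₂ , occ-split = record
      { walk₁    = u₁
      ; walk₂    = walk₂ l ++ reverse u₂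
      ; disjoint = λ e → subst (_≤ 1) (total e) (disjoint l e)
      }
      where
      open ≡-Reasoning
      total : ∀ e → occ (walk₁ l) e ℕ.+ occ (walk₂ l) e ≡ occ u₁ e ℕ.+ occ (walk₂ l ++ reverse u₂) e
      total e = begin
        occ (walk₁ l) e ℕ.+ b                      ≡⟨ cong (ℕ._+ b) (occ-split e) ⟩
        (occ u₁ e ℕ.+ occ u₂ e) ℕ.+ b              ≡⟨ ℕ.+-assoc (occ u₁ e) (occ u₂ e) b ⟩
        occ u₁ e ℕ.+ (occ u₂ e ℕ.+ b)              ≡⟨ cong (occ u₁ e ℕ.+_) (ℕ.+-comm (occ u₂ e) b) ⟩
        occ u₁ e ℕ.+ (b ℕ.+ occ u₂ e)              ≡⟨ cong (λ c → occ u₁ e ℕ.+ (b ℕ.+ c)) (occ-reverse u₂ e) ⟨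
        occ u₁ e ℕ.+ (b ℕ.+ occ (reverse u₂) e)    ≡⟨ cong (occ u₁ e ℕ.+_) (occ-++ (walk₂ l) (reverse u₂) e) ⟨
        occ u₁ e ℕ.+ occ (walk₂ l ++ reverse u₂) e ∎
        where b = occ (walk₂ l) e

    -- walk₁ follows the ear from its foot to z, walk₂ uses e itself.
    splice-link : ∀ {x y z Q e} (l : Link x y) → vertices (walk₁ l) ⊆ Q → vertices (walk₂ l) ⊆ Q →
                  Joins e y z → z ∉ Q → z ∈ S →
                  (r : Ear Q e z) → Ear.foot r ∈ vertices (walk₁ l) → Link x z
    splice-link {x} {y} {z} {Q} {e} l ⊆Q₁ ⊆Q₂ j z∉Q z∈S r foot∈ with split (walk₁ l) foot∈
    ... | u₁ , u₂ , occ-split = record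
      { walk₁    = u₁ ++ Ear.walk r
      ; walk₂    = walk₂ l ++ last
      ; disjoint = λ e′ → subst (_≤ 1)
          (sym (cong₂ ℕ._+_ (occ-++ u₁ (Ear.walk r) e′) (occ-++ (walk₂ l) last e′))) (bound e′)
      }
      where
      last : Walk S y z
      last = cons e (vertices⊆ (walk₂ l) (end∈ (walk₂ l))) j (nil z∈S)

      u₁≤ : ∀ e′ → occ u₁ e′ ≤ occ (walk₁ l) e′
      u₁≤ e′ = subst (occ u₁ e′ ≤_) (sym (occ-split e′)) (ℕ.m≤m+n (occ u₁ e′) (occ u₂ e′))

      off-Q : ∀ e′ → ¬ Inside Q e′ → occ u₁ e′ ≡ 0 × occ (walk₂ l) e′ ≡ 0
      off-Q e′ ¬i =
        ℕ.n≤0⇒n≡0 (subst (occ u₁ e′ ≤_) (occ-outside (walk₁ l) e′ ⊆Q₁ ¬i) (u₁≤ e′)) ,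
        occ-outside (walk₂ l) e′ ⊆Q₂ ¬i

      bound : ∀ e′ → (occ u₁ e′ ℕ.+ occ (Ear.walk r) e′) ℕ.+ (occ (walk₂ l) e′ ℕ.+ occ last e′) ≤ 1
      bound e′ with occ (Ear.walk r) e′ in eq | e ≟ e′
      bound e′ | ℕ.suc _ | yes refl =
        contradiction refl (Ear.avoids r e′ λ eq′ → case trans (sym eq) eq′ of λ ())
      -- An edge of the ear is not inside `Q`, so neither old walk uses it.
      bound e′ | ℕ.suc k | no _ with off-Q e′ (Ear.outside r e′ λ eq′ → case trans (sym eq) eq′ of λ ())
      ... | z₁ , z₂ rewrite z₁ | z₂ | ℕ.+-identityʳ k = subst (_≤ 1) eq (Ear.occ≤1 r e′)
      -- `e` has its end `z` outside `Q`, so it is new to both old walks.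
      bound e′ | ℕ.zero | yes refl with off-Q e (λ i → z∉Q (proj₂ (Inside-Joins j i)))
      ... | z₁ , z₂ rewrite z₁ | z₂ = s≤s z≤n
      bound e′ | ℕ.zero | no _ rewrite ℕ.+-identityʳ (occ u₁ e′) | ℕ.+-identityʳ (occ (walk₂ l) e′) =
        ℕ.≤-trans (ℕ.+-monoˡ-≤ (occ (walk₂ l) e′) (u₁≤ e′)) (disjoint l e′)

    -- If one of the walks already meets `z`, it is cut there. Otherwise the walk containing the
    -- foot of an ear is rerouted along the ear, and the other is prolonged by `e` from the common
    -- end `y`.
    extend-link : ∀ {x y z e} → Link x y → Joins e y z → z ∈ S → Link x z
    extend-link {x} {y} {z} {e} l j z∈S with z ∈? vertices (walk₁ l) | z ∈? vertices (walk₂ l)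
    ... | yes z∈₁ | _       = truncate-link l z∈₁
    ... | no _    | yes z∈₂ = truncate-link (swap-link l) z∈₂
    ... | no z∉₁  | no z∉₂  = close (x∈p∪q⁻ Q₁ Q₂ (Ear.foot∈ r))
      where
      Q₁ Q₂ Q : Subset (nV G)
      Q₁ = vertices (walk₁ l)
      Q₂ = vertices (walk₂ l)
      Q  = Q₁ ∪ Q₂

      z∉Q : z ∉ Q
      z∉Q z∈ with x∈p∪q⁻ Q₁ Q₂ z∈
      ... | inj₁ z∈₁ = z∉₁ z∈₁
      ... | inj₂ z∈₂ = z∉₂ z∈₂

      y∈Q₁ : y ∈ Q₁
      y∈Q₁ = end∈ (walk₁ l)

      r : Ear Q e z
      r = ear Q e y z (p⊆p∪q Q₂ y∈Q₁) (vertices⊆ (walk₁ l) y∈Q₁) z∈S z∉Q j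

      close : Ear.foot r ∈ Q₁ ⊎ Ear.foot r ∈ Q₂ → Link x z
      close (inj₁ f∈₁) = splice-link l (p⊆p∪q Q₂) (q⊆p∪q Q₁ Q₂) j z∉Q z∈S r f∈₁
      close (inj₂ f∈₂) = splice-link (swap-link l) (q⊆p∪q Q₁ Q₂) (p⊆p∪q Q₂) j z∉Q z∈S r f∈₂

    -- A set of vertices linked to `x` is enlarged across an edge leaving it; `S-conn` supplies such
    -- an edge as long as `y` is missing.
    link : ∀ x y → x ∈ S → y ∈ S → Link x y
    link x y x∈S y∈S = grow Linked step ⁅ x ⁆ (x∈⁅x⁆ x , (λ v∈ → proj₁ (start v∈)) , λ v∈ → proj₂ (start v∈))
      where
      Linked : Subset (nV G) → Set
      Linked T = x ∈ T × T ⊆ S × (∀ {v} → v ∈ T → Link x v)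

      start : ∀ {v} → v ∈ ⁅ x ⁆ → v ∈ S × Link x v
      start v∈ with x∈⁅y⁆⇒x≡y x v∈
      ... | refl = x∈S , record { walk₁ = nil x∈S ; walk₂ = nil x∈S ; disjoint = λ _ → z≤n }

      step : ∀ T → Linked T → Link x y ⊎ ∃ λ T′ → T ⊂ T′ × Linked T′
      step T (x∈T , T⊆S , linked) with y ∈? T
      ... | yes y∈T = inj₁ (linked y∈T)
      ... | no  y∉T with S-conn T T⊆S (x , x∈T) (y , ∈∖⁺ S T y∈S y∉T)
      ...   | e , _ , cross , _ with between⁻ cross
      ...     | v , z , j , v∈T , z∈ with ∈∖⁻ S T z∈
      ...       | z∈S , z∉T =
        inj₂ (T ∪ ⁅ z ⁆ , ⊂-insert T z∉T , p⊆p∪q ⁅ z ⁆ x∈T ,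
              (λ w∈ → proj₁ (new w∈)) , λ w∈ → proj₂ (new w∈))
        where
        new : ∀ {w} → w ∈ T ∪ ⁅ z ⁆ → w ∈ S × Link x w
        new w∈ with ∈-insert⁻ T w∈
        ... | inj₁ w∈T  = T⊆S w∈T , linked w∈T
        ... | inj₂ refl = z∈S , extend-link (linked v∈T) j z∈S

  -- Minimal sets with at most one edge to the rest of `K`

  module _ (K : Subset (nV G)) where

    -- Only edges within `K` are counted; any number may lead out of `K`. The minimal such sets are
    -- the leaves and isolated nodes of the bridge forest of the subgraph induced by `K`.
    Leaf : Subset (nV G) → Set
    Leaf S = Nonempty S × S ⊆ K × AtMostOne (Between S (K ∖ S))

    leaf? : ∀ S → Dec (Leaf S)
    leaf? S = nonempty? S ×-dec ((S ⊆? K) ×-dec atMostOne? (between? S (K ∖ S)))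

    -- `K ∖ K` is empty, so the search for a minimal leaf can start at `K` itself.
    K-leaf : Nonempty K → Leaf K
    K-leaf K≢∅ = K≢∅ , (λ v∈ → v∈) , λ e e′ cross _ → case between⁻ cross of λ
      { (_ , _ , _ , _ , y∈) → case ∈∖⁻ K K y∈ of λ { (y∈K , y∉K) → contradiction y∈K y∉K } }

    -- If T and S ∖ T were joined by at most one edge, each would, not being a leaf, have an edge
    -- to K ∖ S; but only one edge leads from S to K ∖ S.
    minimal-leaf-connected : ∀ {S} → Leaf S → (∀ T → T ⊂ S → ¬ Leaf T) → EdgeConnected₂ S
    minimal-leaf-connected {S} (_ , S⊆K , S≤1) S-min T T⊆S (t , t∈T) (s , s∈)
      with atMostOne-or-two (between? T (S ∖ T))
    ... | inj₂ two = two
    ... | inj₁ T≤1 = contradiction (exit R (r⊂S , (s , s∈) , R≤1)) (disagree (exit T (t⊂S , (t , t∈T) , T≤1)))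
      where
      R : Subset (nV G)
      R = S ∖ T

      t⊂S : T ⊂ S
      t⊂S = T⊆S , s , ∈∖⁻ S T s∈

      r⊂S : R ⊂ S
      r⊂S = ∖-⊂ S T (T⊆S t∈T) t∈T

      R≤1 : AtMostOne (Between R (S ∖ R))
      R≤1 e e′ c c′ = T≤1 e e′ (flip e c) (flip e′ c′)
        where
        flip : ∀ e → Between R (S ∖ R) e → Between T (S ∖ T) e
        flip e c with between⁻ c
        ... | x , y , j , x∈R , y∈ with y ∈? T | ∈∖⁻ S R y∈
        ...   | yes y∈T | _ = between⁺ (Joins-sym j) y∈T x∈R
        ...   | no y∉T  | y∈S , y∉R = contradiction (∈∖⁺ S T y∈S y∉T) y∉R

      exit : ∀ U → U ⊂ S × Nonempty U × AtMostOne (Between U (S ∖ U)) → ∃ λ e → Between U (K ∖ S) e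
      exit U (U⊂S , U≢∅ , U≤1) with atMostOne-or-two (between? U (K ∖ U))
      ... | inj₁ ≤1 = ⊥-elim (S-min U U⊂S (U≢∅ , (λ v∈U → S⊆K (proj₁ U⊂S v∈U)) , ≤1))
      ... | inj₂ (e , e′ , c , c′ , e≢e′) with between⁻ c | between⁻ c′
      ... | x , y , j , x∈ , y∈ | x′ , y′ , j′ , x′∈ , y′∈ with y ∈? S | y′ ∈? S | ∈∖⁻ K U y∈ | ∈∖⁻ K U y′∈
      ... | no y∉S  | _        | y∈K , _ | _       = e , between⁺ j x∈ (∈∖⁺ K S y∈K y∉S)
      ... | yes _   | no y′∉S  | _ | y′∈K , _      = e′ , between⁺ j′ x′∈ (∈∖⁺ K S y′∈K y′∉S)
      ... | yes y∈S | yes y′∈S | _ , y∉U | _ , y′∉U =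
        contradiction (U≤1 e e′ (between⁺ j x∈ (∈∖⁺ S U y∈S y∉U)) (between⁺ j′ x′∈ (∈∖⁺ S U y′∈S y′∉U))) e≢e′

      -- Both exits would be the single edge from `S` to `K ∖ S`, whose end in `S` cannot lie in `T`
      -- and in `R`.
      disagree : (∃ λ e → Between T (K ∖ S) e) → ¬ (∃ λ e → Between R (K ∖ S) e)
      disagree (e , c) (e′ , c′) with between⁻ c | between⁻ c′
      ... | x , y , j , x∈T , y∈ | x′ , y′ , j′ , x′∈R , y′∈
        with S≤1 e e′ (between⁺ j (T⊆S x∈T) y∈) (between⁺ j′ (proj₁ (∈∖⁻ S T x′∈R)) y′∈)
      ... | refl with Joins-unique j j′
      ...   | inj₁ (refl , _) = proj₂ (∈∖⁻ S T x′∈R) x∈T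
      ...   | inj₂ (refl , _) = proj₂ (∈∖⁻ K S y′∈) (T⊆S x∈T)

-- Arithmetic modulo `suc j` and the passage to `IsFlow`

module ℤ/1+ (j : ℕ) where

  infixl 20 _⊞_
  _⊞_ : Fin (ℕ.suc j) → Fin (ℕ.suc j) → Fin (ℕ.suc j)
  x ⊞ y = (toℕ x ℕ.+ toℕ y) mod ℕ.suc j

  -- The outer `mod` matters at `x = zero`, where the difference is the modulus itself.
  ⊟_ : Fin (ℕ.suc j) → Fin (ℕ.suc j)
  ⊟ x = (ℕ.suc j ℕ.∸ toℕ x) mod ℕ.suc j

  -- All quantifiers range over a finite type, so the laws are decidable: for the moduli 2 and 3
  -- they come out of evaluating `laws?`.
  Laws : Set
  Laws = (∀ x y z → (x ⊞ y) ⊞ z ≡ x ⊞ (y ⊞ z)) × (∀ x y → x ⊞ y ≡ y ⊞ x) ×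
         (∀ x → zero ⊞ x ≡ x) × (∀ x → (⊟ x) ⊞ x ≡ zero)

  laws? : Dec Laws
  laws? = all? (λ x → all? λ y → all? λ z → (x ⊞ y) ⊞ z ≟ x ⊞ (y ⊞ z)) ×-dec
          (all? (λ x → all? λ y → x ⊞ y ≟ y ⊞ x) ×-dec
          (all? (λ x → zero ⊞ x ≟ x) ×-dec all? (λ x → (⊟ x) ⊞ x ≟ zero)))

  isAbelianGroup : Laws → IsAbelianGroup _≡_ _⊞_ zero ⊟_
  isAbelianGroup (assoc , comm , identityˡ , inverseˡ) = record
    { isGroup = record
      { isMonoid = record
        { isSemigroup = record
          { isMagma = record { isEquivalence = isEquivalence ; ∙-cong = cong₂ _⊞_ }
          ; assoc   = assoc
          }
        ; identity = identityˡ , λ x → trans (comm x zero) (identityˡ x)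
        }
      ; inverse = inverseˡ , λ x → trans (comm x (⊟ x)) (inverseˡ x)
      ; ⁻¹-cong = cong ⊟_
      }
    ; comm = comm
    }

  -- `sumℤ` reduces once, after adding naturals, while `⊞` reduces at every step; compatibility of
  -- remainders with addition reconciles the two.
  sumℤ-∷ : ∀ x xs → sumℤ (ℕ.suc j) (x ∷ xs) ≡ x ⊞ sumℤ (ℕ.suc j) xs
  sumℤ-∷ x xs = toℕ-injective (begin
    toℕ ((toℕ x ℕ.+ s) mod k)            ≡⟨ toℕ-fromℕ< _ ⟩
    (toℕ x ℕ.+ s) % k                    ≡⟨ %-distribˡ-+ (toℕ x) s k ⟩
    (toℕ x % k ℕ.+ s % k) % k            ≡⟨ cong (λ a → (a ℕ.+ s % k) % k) (m<n⇒m%n≡m (toℕ<n x)) ⟩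
    (toℕ x ℕ.+ s % k) % k                ≡⟨ cong (λ a → (toℕ x ℕ.+ a) % k) (toℕ-fromℕ< (m%n<n s k)) ⟨
    (toℕ x ℕ.+ toℕ (s mod k)) % k        ≡⟨ toℕ-fromℕ< _ ⟨
    toℕ (x ⊞ (s mod k))                  ∎)
    where
    open ≡-Reasoning
    k = ℕ.suc j
    s = ListAction.sum (List.map toℕ xs)

  module _ (laws : Laws) where

    open Chains (isAbelianGroup laws)
    open CommutativeMonoidSum (AbelianGroup.commutativeMonoid 𝔸) using (sum)

    -- An arbitrary `g` is tabulated because the induction on `m` replaces `g` by `g ∘ suc`; the
    -- identity gives `allFin`.
    sumℤ-filter : ∀ {m n} (f : Fin n → Fin (ℕ.suc j)) {P : Fin n → Set} (P? : ∀ i → Dec (P i))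
                  (g : Fin m → Fin n) →
                  sumℤ (ℕ.suc j) (List.map f (List.filter P? (List.tabulate g))) ≡
                  sum (λ i → does (P? (g i)) ▸ f (g i))
    sumℤ-filter {ℕ.zero}  f P? g = refl
    sumℤ-filter {ℕ.suc m} f P? g with does (P? (g zero))
    ... | true  = trans (sumℤ-∷ (f (g zero)) (List.map f (List.filter P? (List.tabulate (g ∘ suc)))))
                        (cong (f (g zero) ⊞_) (sumℤ-filter f P? (g ∘ suc)))
    ... | false = trans (sumℤ-filter f P? (g ∘ suc)) (sym (+-identityˡ _))

    balanced⇒IsFlow : ∀ G f → (∀ v → ∂ G f v ≡ zero) → IsFlow G (ℕ.suc j) f
    balanced⇒IsFlow G f ∂f≡0 v = begin
      sumℤ (ℕ.suc j) (List.map f (δ⁺ G v))  ≡⟨ sumℤ-filter f (λ e → tail G e ≟ v) (λ e → e) ⟩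
      outflow G f v                         ≡⟨ x∙y⁻¹≈ε⇒x≈y (inflow G f v) (outflow G f v) (∂f≡0 v) ⟨
      inflow G f v                          ≡⟨ sumℤ-filter f (λ e → head G e ≟ v) (λ e → e) ⟨
      sumℤ (ℕ.suc j) (List.map f (δ⁻ G v))  ∎
      where
      open ≡-Reasoning
      open AbelianGroupProperties 𝔸 using (x∙y⁻¹≈ε⇒x≈y)

-- The induction, over a nontrivial group `A₂` and a group `A₃` with at least three elements

module Induction (G : Digraph)
  {A₂ : Set} {_+₂_ : A₂ → A₂ → A₂} {0₂ : A₂} { -₂_ : A₂ → A₂}
  (A₂-group : IsAbelianGroup _≡_ _+₂_ 0₂ -₂_)
  {A₃ : Set} {_+₃_ : A₃ → A₃ → A₃} {0₃ : A₃} { -₃_ : A₃ → A₃}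
  (A₃-group : IsAbelianGroup _≡_ _+₃_ 0₃ -₃_)
  (nontrivial : ∃ λ a → a ≢ 0₂)
  (avoid-two : ∀ (p q : A₃) → ∃ λ a → a ≢ p × a ≢ q)
  where

  module C₂ = Chains A₂-group
  module C₃ = Chains A₃-group

  open Graph G
  open Trails G

  record Solution (K : Subset (nV G)) : Set where
    field
      f₂          : E → A₂
      f₃          : E → A₃
      balanced₂   : ∀ v → v ∈ K → C₂.∂ G f₂ v ≡ 0₂
      balanced₃   : ∀ v → v ∈ K → C₃.∂ G f₃ v ≡ 0₃
      nowhereZero : ∀ e → (f₂ e ≢ 0₂) ⊎ (f₃ e ≢ 0₃)
      vanishes    : ∀ e → ¬ Inside K e → f₂ e ≡ 0₂

  open Solution

  -- 2-edge-connectedness of the graph in which everything outside `K` is one vertex. It passes to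
  -- subsets of `K`, so it survives every contraction.
  Cuts : Subset (nV G) → Set
  Cuts K = ∀ T → T ⊆ K → Nonempty T → Two (Between T (∁ T))

  solve-∅ : ∀ K → ¬ Nonempty K → Solution K
  solve-∅ K K≡∅ = record
    { f₂          = λ _ → 0₂
    -- Forbidding `0₃` twice yields a nonzero constant; with `K` empty no vertex asks for
    -- conservation.
    ; f₃          = λ _ → proj₁ (avoid-two 0₃ 0₃)
    ; balanced₂   = λ v v∈K → contradiction (v , v∈K) K≡∅
    ; balanced₃   = λ v v∈K → contradiction (v , v∈K) K≡∅
    ; nowhereZero = λ _ → inj₂ (proj₁ (proj₂ (avoid-two 0₃ 0₃)))
    ; vanishes    = λ _ _ → refl
    }

  -- A vertex of `W` counts as outside for the smaller problem. Hence `f₂ s` is automatically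
  -- balanced on `W`, and a chain added on edges at `W` meets only zeros.
  f₂-contracted : ∀ {K W v e} (s : Solution (K ∖ W)) → v ∈ W → Incident G e v → f₂ s e ≡ 0₂
  f₂-contracted {K} {W} s v∈W (inj₁ refl) = vanishes s _ λ i → proj₂ (∈∖⁻ K W (proj₁ i)) v∈W
  f₂-contracted {K} {W} s v∈W (inj₂ refl) = vanishes s _ λ i → proj₂ (∈∖⁻ K W (proj₂ i)) v∈W

  Joins-Incidentʳ : ∀ {e x y} → Joins e x y → Incident G e y
  Joins-Incidentʳ (inj₁ (_ , p)) = inj₂ p
  Joins-Incidentʳ (inj₂ (p , _)) = inj₁ p

  solve-pendant : ∀ K S v p d e → S ⊆ K → v ∈ S → p ∉ K → Joins d p v → e ≢ d →
                  Between S (∁ S) e →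
                  (∀ e′ → Between S (∁ S) e′ → e′ ≡ d ⊎ e′ ≡ e) →
                  Solution (K ∖ ⁅ v ⁆) → Solution K
  solve-pendant K S v p d e S⊆K v∈S p∉K j e≢d e-cross cross s = record
    { f₂          = f₂ s
    ; f₃          = g
    ; balanced₂   = bal₂
    ; balanced₃   = bal₃
    ; nowhereZero = nz
    ; vanishes    = λ e′ ¬i → vanishes s e′ λ i →
        ¬i (proj₁ (∈∖⁻ K ⁅ v ⁆ (proj₁ i)) , proj₁ (∈∖⁻ K ⁅ v ⁆ (proj₂ i)))
    }
    where
    open ≡-Reasoning

    -- `d` comes from `p` outside `K`, so a correction on it is felt in `K` at `v` alone.
    a : A₃
    a = -₃ C₃.∂ G (f₃ s) v

    g : E → A₃
    g = C₃._⊕_ G (f₃ s) (C₃.dart G j a)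

    f₂-v : ∀ e′ → Incident G e′ v → f₂ s e′ ≡ 0₂
    f₂-v e′ = f₂-contracted s (x∈⁅x⁆ v)

    bal₂ : ∀ x → x ∈ K → C₂.∂ G (f₂ s) x ≡ 0₂
    bal₂ x x∈K with x ≟ v
    ... | yes refl = C₂.∂-null G (f₂ s) v f₂-v
    ... | no x≢v   = balanced₂ s x (∈∖⁺ K ⁅ v ⁆ x∈K (x≢y⇒x∉⁅y⁆ x≢v))

    bal₃ : ∀ x → x ∈ K → C₃.∂ G g x ≡ 0₃
    bal₃ x x∈K = begin
      C₃.∂ G g x
        ≡⟨ C₃.∂-⊕ G (f₃ s) (C₃.dart G j a) x ⟩
      C₃.∂ G (f₃ s) x +₃ C₃.∂ G (C₃.dart G j a) x
        ≡⟨ cong (C₃.∂ G (f₃ s) x +₃_) (C₃.∂-dart-arrives G j a λ { refl → p∉K x∈K }) ⟩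
      C₃.∂ G (f₃ s) x +₃ C₃.point G v a x
        ≡⟨ cancel (x ≟ v) ⟩
      0₃ ∎
      where
      cancel : Dec (x ≡ v) → C₃.∂ G (f₃ s) x +₃ C₃.point G v a x ≡ 0₃
      cancel (yes refl) = trans (cong (C₃.∂ G (f₃ s) v +₃_) (C₃.point-same G v a))
                                (C₃.+-inverseʳ (C₃.∂ G (f₃ s) v))
      cancel (no x≢v)   = trans (cong₂ _+₃_ (balanced₃ s x (∈∖⁺ K ⁅ v ⁆ x∈K (x≢y⇒x∉⁅y⁆ x≢v)))
                                           (C₃.point-other G v a x≢v))
                                (C₃.+-identityˡ 0₃)

    g-other : ∀ {e′} → e′ ≢ d → g e′ ≡ f₃ s e′
    g-other {e′} e′≢d = trans (cong (f₃ s e′ +₃_) (C₃.dart-other G j a e′≢d)) (C₃.+-identityʳ _)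

    f₂d≡0 : f₂ s d ≡ 0₂
    f₂d≡0 = f₂-v d (Joins-Incidentʳ j)

    f₂e≡0 : f₂ s e ≡ 0₂
    f₂e≡0 = C₂.cut-rule G S (f₂ s) e (λ x x∈S → bal₂ x (S⊆K x∈S)) e-cross others
      where
      others : ∀ e′ → e′ ≢ e → Between S (∁ S) e′ → f₂ s e′ ≡ 0₂
      others e′ e′≢e c with cross e′ c
      ... | inj₁ refl = f₂d≡0
      ... | inj₂ refl = contradiction refl e′≢e

    -- If `g d` were zero, the 2-edge cut would force `f₃ s e` to be zero as well; together with
    -- `f₂e≡0` this contradicts `nowhereZero` at `e`.
    gd≢0 : g d ≢ 0₃
    gd≢0 gd≡0 with nowhereZero s e
    ... | inj₁ f₂e≢0 = f₂e≢0 f₂e≡0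
    ... | inj₂ f₃e≢0 = f₃e≢0 (trans (sym (g-other e≢d))
      (C₃.cut-rule G S g e (λ x x∈S → bal₃ x (S⊆K x∈S)) e-cross others))
      where
      others : ∀ e′ → e′ ≢ e → Between S (∁ S) e′ → g e′ ≡ 0₃
      others e′ e′≢e c with cross e′ c
      ... | inj₁ refl = gd≡0
      ... | inj₂ refl = contradiction refl e′≢e

    nz : ∀ e′ → (f₂ s e′ ≢ 0₂) ⊎ (g e′ ≢ 0₃)
    nz e′ with e′ ≟ d
    ... | yes refl = inj₂ gd≢0
    ... | no e′≢d rewrite g-other e′≢d = nowhereZero s e′

  -- a is determined by b, so each of the two inequalities excludes one value of b.
  choose : ∀ {e e′ v p v′ p′} (j : Joins e p v) (j′ : Joins e′ p′ v′) r x y →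
    ∃₂ λ a b → r +₃ (a +₃ b) ≡ 0₃ × x +₃ C₃.signed G j a ≢ 0₃ × y +₃ C₃.signed G j′ b ≢ 0₃
  choose j j′ r x y with avoid-two (C₃.signed G j′ (-₃ y)) ((-₃ r) +₃ (-₃ C₃.signed G j (-₃ x)))
  ... | b , b≢₁ , b≢₂ = (-₃ (r +₃ b)) , b , total , first , λ eq → b≢₁ (C₃.signed-unique G j′ y b eq)
    where
    open ≡-Reasoning
    total : r +₃ ((-₃ (r +₃ b)) +₃ b) ≡ 0₃
    total = begin
      r +₃ ((-₃ (r +₃ b)) +₃ b)  ≡⟨ cong (r +₃_) (C₃.+-comm (-₃ (r +₃ b)) b) ⟩
      r +₃ (b +₃ (-₃ (r +₃ b)))  ≡⟨ C₃.+-assoc r b (-₃ (r +₃ b)) ⟨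
      (r +₃ b) +₃ (-₃ (r +₃ b))  ≡⟨ C₃.+-inverseʳ (r +₃ b) ⟩
      0₃ ∎

    first : x +₃ C₃.signed G j (-₃ (r +₃ b)) ≢ 0₃
    first eq = b≢₂ (begin
      b                                            ≡⟨ C₃.+-identityˡ b ⟨
      0₃ +₃ b                                      ≡⟨ cong (_+₃ b) (C₃.+-inverseˡ r) ⟨
      ((-₃ r) +₃ r) +₃ b                           ≡⟨ C₃.+-assoc (-₃ r) r b ⟩
      (-₃ r) +₃ (r +₃ b)                           ≡⟨ cong ((-₃ r) +₃_) (C₃.neg-involutive (r +₃ b)) ⟨
      (-₃ r) +₃ (-₃ (-₃ (r +₃ b)))                 ≡⟨ cong (λ c → (-₃ r) +₃ (-₃ c)) (C₃.signed-unique G j x _ eq) ⟩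
      (-₃ r) +₃ (-₃ C₃.signed G j (-₃ x))          ∎)

  -- Contracting a closed trail

  module SolveTrail (K S : Subset (nV G)) (v p v′ p′ : V) (d d′ : E) (S⊆K : S ⊆ K) (d≢d′ : d ≢ d′)
    (p∉K : p ∉ K) (p′∉K : p′ ∉ K) (j : Joins d p v) (j′ : Joins d′ p′ v′)
    (S-conn : EdgeConnected₂ S) (l : Link S-conn v v′) where

    open Link l
    open ≡-Reasoning

    trail : Walk S v v
    trail = walk₁ ++ reverse walk₂

    occ-trail : ∀ e → occ trail e ≡ occ walk₁ e ℕ.+ occ walk₂ e
    occ-trail e = trans (occ-++ walk₁ (reverse walk₂) e) (cong (occ walk₁ e ℕ.+_) (occ-reverse walk₂ e))

    W K′ : Subset (nV G)
    W  = vertices trail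
    K′ = K ∖ W

    v∈W : v ∈ W
    v∈W = start∈ trail

    K′⊂K : K′ ⊂ K
    K′⊂K = ∖-⊂ K W (S⊆K (vertices⊆ trail v∈W)) v∈W

    trail⊆K : vertices trail ⊆ K
    trail⊆K x∈ = S⊆K (vertices⊆ trail x∈)

    module _ (s : Solution K′) where

      c : A₂
      c = proj₁ nontrivial

      f : E → A₂
      f = C₂._⊕_ G (f₂ s) (C₂.chain G trail c)

      pushed : Σ (E → A₃) λ g′ →
        (∀ e → occ trail e ≡ 0 → g′ e ≡ f₃ s e) ×
        (∀ x → x ∈ W → x ≢ v → C₃.∂ G g′ x ≡ 0₃) ×
        (∀ x → x ∉ W → C₃.∂ G g′ x ≡ C₃.∂ G (f₃ s) x)
      pushed = C₃.push G trail (f₃ s)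

      g₀ : E → A₃
      g₀ = proj₁ pushed

      lead : Walk ⊤ v v
      lead = nil ∈⊤

      -- What enters by `d′` arrives at `v′` and must go on to `v`, where `push` has gathered the
      -- excess of the trail. This runs along the trail, where `f₃` is free. The walk is taken in
      -- `⊤` because `d′`, put before it, starts outside `S`.
      lead′ : Walk ⊤ v′ v
      lead′ = weaken (λ _ → ∈⊤) (reverse walk₁)

      choice : ∃₂ λ a b → C₃.∂ G g₀ v +₃ (a +₃ b) ≡ 0₃ ×
        g₀ d +₃ C₃.signed G j a ≢ 0₃ × g₀ d′ +₃ C₃.signed G j′ b ≢ 0₃
      choice = choose j j′ (C₃.∂ G g₀ v) (g₀ d) (g₀ d′)

      a b : A₃
      a = proj₁ choice
      b = proj₁ (proj₂ choice)

      h h′ g : E → A₃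
      h  = C₃.chain G (cons d ∈⊤ j lead) a
      h′ = C₃.chain G (cons d′ ∈⊤ j′ lead′) b
      g  = C₃._⊕_ G g₀ (C₃._⊕_ G h h′)

      bal₂ : ∀ x → x ∈ K → C₂.∂ G f x ≡ 0₂
      bal₂ x x∈K = begin
        C₂.∂ G f x
          ≡⟨ C₂.∂-⊕ G (f₂ s) (C₂.chain G trail c) x ⟩
        C₂.∂ G (f₂ s) x +₂ C₂.∂ G (C₂.chain G trail c) x
          ≡⟨ cong₂ _+₂_ old (trans (C₂.∂-chain G trail c x) (C₂.+-inverseʳ _)) ⟩
        0₂ +₂ 0₂
          ≡⟨ C₂.+-identityˡ 0₂ ⟩
        0₂ ∎
        where
        old : C₂.∂ G (f₂ s) x ≡ 0₂
        old with x ∈? W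
        ... | yes x∈W = C₂.∂-null G (f₂ s) x λ _ → f₂-contracted s x∈W
        ... | no x∉W  = balanced₂ s x (∈∖⁺ K W x∈K x∉W)

      bal₃ : ∀ x → x ∈ K → C₃.∂ G g x ≡ 0₃
      bal₃ x x∈K = begin
        C₃.∂ G g x
          ≡⟨ C₃.∂-⊕ G g₀ (C₃._⊕_ G h h′) x ⟩
        C₃.∂ G g₀ x +₃ C₃.∂ G (C₃._⊕_ G h h′) x
          ≡⟨ cong (C₃.∂ G g₀ x +₃_) (C₃.∂-⊕ G h h′ x) ⟩
        C₃.∂ G g₀ x +₃ (C₃.∂ G h x +₃ C₃.∂ G h′ x)
          ≡⟨ cong (C₃.∂ G g₀ x +₃_) (cong₂ _+₃_
               (C₃.∂-chain-arrives G (cons d ∈⊤ j lead) a λ { refl → p∉K x∈K })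
               (C₃.∂-chain-arrives G (cons d′ ∈⊤ j′ lead′) b λ { refl → p′∉K x∈K })) ⟩
        C₃.∂ G g₀ x +₃ (C₃.point G v a x +₃ C₃.point G v b x)
          ≡⟨ cancel (x ≟ v) (x ∈? W) ⟩
        0₃ ∎
        where
        cancel : Dec (x ≡ v) → Dec (x ∈ W) →
                 C₃.∂ G g₀ x +₃ (C₃.point G v a x +₃ C₃.point G v b x) ≡ 0₃
        cancel (yes refl) _ = trans
          (cong (C₃.∂ G g₀ v +₃_) (cong₂ _+₃_ (C₃.point-same G v a) (C₃.point-same G v b)))
          (proj₁ (proj₂ (proj₂ choice)))
        cancel (no x≢v) x∈W? = trans
          (cong₂ _+₃_ (old x∈W?) (cong₂ _+₃_ (C₃.point-other G v a x≢v) (C₃.point-other G v b x≢v)))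
          (trans (C₃.+-identityˡ _) (C₃.+-identityˡ 0₃))
          where
          old : Dec (x ∈ W) → C₃.∂ G g₀ x ≡ 0₃
          old (yes x∈W) = proj₁ (proj₂ (proj₂ pushed)) x x∈W x≢v
          old (no x∉W)  = trans (proj₂ (proj₂ (proj₂ pushed)) x x∉W) (balanced₃ s x (∈∖⁺ K W x∈K x∉W))

      unused : ∀ e → occ trail e ≡ 0 → occ lead′ e ≡ 0
      unused e e∉ = trans (trans (occ-weaken (λ _ → ∈⊤) (reverse walk₁) e) (occ-reverse walk₁ e))
        (ℕ.m+n≡0⇒m≡0 (occ walk₁ e) (trans (sym (occ-trail e)) e∉))

      exit-unused : ∀ {q x e} → Joins e q x → q ∉ K → occ trail e ≡ 0
      exit-unused i q∉K = occ-outside trail _ trail⊆K λ inside → q∉K (proj₁ (Inside-Joins i inside))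

      d≢0 : g d ≢ 0₃
      d≢0 gd≡0 = proj₁ (proj₂ (proj₂ (proj₂ choice))) (begin
        g₀ d +₃ C₃.signed G j a
          ≡⟨ cong (g₀ d +₃_) (trans (C₃.+-identityʳ _) (C₃.+-identityʳ _)) ⟨
        g₀ d +₃ ((C₃.signed G j a +₃ 0₃) +₃ 0₃)
          ≡⟨ cong (g₀ d +₃_) (cong₂ _+₃_ (cong (_+₃ 0₃) (C₃.dart-same G j a)) h′d) ⟨
        g d
          ≡⟨ gd≡0 ⟩
        0₃ ∎)
        where
        h′d : h′ d ≡ 0₃
        h′d = trans (cong₂ _+₃_ (C₃.dart-other G j′ b d≢d′)
                                (C₃.chain-unused G lead′ b d (unused d (exit-unused j p∉K))))
                    (C₃.+-identityˡ 0₃)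

      d′≢0 : g d′ ≢ 0₃
      d′≢0 gd′≡0 = proj₂ (proj₂ (proj₂ (proj₂ choice))) (begin
        g₀ d′ +₃ C₃.signed G j′ b
          ≡⟨ cong (g₀ d′ +₃_) (trans (C₃.+-identityˡ _) (C₃.+-identityʳ _)) ⟨
        g₀ d′ +₃ (0₃ +₃ (C₃.signed G j′ b +₃ 0₃))
          ≡⟨ cong (g₀ d′ +₃_) (cong₂ _+₃_
               (trans (C₃.+-identityʳ _) (C₃.dart-other G j a (d≢d′ ∘ sym)))
               (cong₂ _+₃_ (C₃.dart-same G j′ b)
                           (C₃.chain-unused G lead′ b d′ (unused d′ (exit-unused j′ p′∉K))))) ⟨
        g d′
          ≡⟨ gd′≡0 ⟩
        0₃ ∎)

      off-trail₂ : ∀ e → occ trail e ≡ 0 → f e ≡ f₂ s e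
      off-trail₂ e e∉ = trans (cong (f₂ s e +₂_) (C₂.chain-unused G trail c e e∉)) (C₂.+-identityʳ _)

      off-trail₃ : ∀ e → e ≢ d → e ≢ d′ → occ trail e ≡ 0 → g e ≡ f₃ s e
      off-trail₃ e e≢d e≢d′ e∉ = begin
        g₀ e +₃ ((C₃.dart G j a e +₃ 0₃) +₃ (C₃.dart G j′ b e +₃ C₃.chain G lead′ b e))
          ≡⟨ cong (g₀ e +₃_) (cong₂ _+₃_ (cong (_+₃ 0₃) (C₃.dart-other G j a e≢d))
               (cong₂ _+₃_ (C₃.dart-other G j′ b e≢d′) (C₃.chain-unused G lead′ b e (unused e e∉)))) ⟩
        g₀ e +₃ ((0₃ +₃ 0₃) +₃ (0₃ +₃ 0₃))
          ≡⟨ cong (g₀ e +₃_) (cong₂ _+₃_ (C₃.+-identityˡ 0₃) (C₃.+-identityˡ 0₃)) ⟩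
        g₀ e +₃ (0₃ +₃ 0₃)
          ≡⟨ cong (g₀ e +₃_) (C₃.+-identityˡ 0₃) ⟩
        g₀ e +₃ 0₃
          ≡⟨ C₃.+-identityʳ _ ⟩
        g₀ e
          ≡⟨ proj₁ (proj₂ pushed) e e∉ ⟩
        f₃ s e ∎

      -- A trail edge has its ends in `W`, so `f₂ s` is zero on it, and it is used exactly once;
      -- hence `f e` is `c` or `-₂ c`.
      on-trail : ∀ e → occ trail e ≢ 0 → f e ≢ 0₂
      on-trail e e∈ fe≡0 = case C₂.chain-once G trail c e once of λ
        { (inj₁ eq) → proj₂ nontrivial (trans (sym eq) chain≡0)
        ; (inj₂ eq) → proj₂ nontrivial
            (trans (sym (C₂.neg-involutive c)) (trans (cong -₂_ (trans (sym eq) chain≡0)) C₂.neg-zero)) }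
        where
        once : occ trail e ≡ 1
        once = ℕ.≤-antisym (subst (_≤ 1) (sym (occ-trail e)) (disjoint e)) (ℕ.n≢0⇒n>0 e∈)

        chain≡0 : C₂.chain G trail c e ≡ 0₂
        chain≡0 = begin
          C₂.chain G trail c e              ≡⟨ C₂.+-identityˡ _ ⟨
          0₂ +₂ C₂.chain G trail c e        ≡⟨ cong (_+₂ C₂.chain G trail c e)
                                                    (f₂-contracted s (proj₁ (occ-Inside trail e e∈)) (inj₁ refl)) ⟨
          f e                               ≡⟨ fe≡0 ⟩
          0₂                                ∎

      -- The choice of `a` and `b` covers the two exits, `f` covers the trail, and all remaining
      -- edges keep both of their old values.
      nz : ∀ e → (f e ≢ 0₂) ⊎ (g e ≢ 0₃)
      nz e with e ≟ d | e ≟ d′ | occ trail e ℕ.≟ 0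
      ... | yes refl | _        | _     = inj₂ d≢0
      ... | no _     | yes refl | _     = inj₂ d′≢0
      ... | no _     | no _     | no e∈ = inj₁ (on-trail e e∈)
      ... | no e≢d   | no e≢d′  | yes e∉ with nowhereZero s e
      ...   | inj₁ ≢0 = inj₁ λ fe≡0 → ≢0 (trans (sym (off-trail₂ e e∉)) fe≡0)
      ...   | inj₂ ≢0 = inj₂ λ ge≡0 → ≢0 (trans (sym (off-trail₃ e e≢d e≢d′ e∉)) ge≡0)

      solve-trail : Solution K
      solve-trail = record
        { f₂          = f
        ; f₃          = g
        ; balanced₂   = bal₂
        ; balanced₃   = bal₃
        ; nowhereZero = nz
        ; vanishes    = λ e ¬i → trans (off-trail₂ e (occ-outside trail e trail⊆K ¬i))
            (vanishes s e λ i → ¬i (proj₁ (∈∖⁻ K W (proj₁ i)) , proj₁ (∈∖⁻ K W (proj₂ i))))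
        }

  -- The exits of a leaf, and the recursion on `K`

  data Exits (K S : Subset (nV G)) : Set where
    pendant : ∀ d e → Between S (∁ K) d → Between S (K ∖ S) e →
              (∀ e′ → Between S (∁ S) e′ → e′ ≡ d ⊎ e′ ≡ e) → Exits K S
    several : ∀ d d′ → Between S (∁ K) d → Between S (∁ K) d′ → d ≢ d′ → Exits K S

  classify : ∀ K S e → Between S (∁ S) e → Between S (∁ K) e ⊎ Between S (K ∖ S) e
  classify K S e c with between⁻ c
  ... | x , y , j , x∈S , y∈ with y ∈? K
  ...   | yes y∈K = inj₂ (between⁺ j x∈S (∈∖⁺ K S y∈K (x∈∁p⇒x∉p y∈)))
  ...   | no y∉K  = inj₁ (between⁺ j x∈S (x∉p⇒x∈∁p y∉K))

  -- At least two edges leave `S`, and at most one of them goes to `K ∖ S`. So either two go out of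
  -- `K`, or exactly one goes each way.
  exits : ∀ K S → Leaf K S → Two (Between S (∁ S)) → Exits K S
  exits K S (_ , S⊆K , S≤1) (e₁ , e₂ , c₁ , c₂ , e₁≢e₂) with atMostOne-or-two (between? S (∁ K))
  ... | inj₂ (d , d′ , c , c′ , d≢d′) = several d d′ c c′ d≢d′
  ... | inj₁ ≤1 with classify K S e₁ c₁ | classify K S e₂ c₂
  ... | inj₁ o₁ | inj₁ o₂ = contradiction (≤1 e₁ e₂ o₁ o₂) e₁≢e₂
  ... | inj₂ k₁ | inj₂ k₂ = contradiction (S≤1 e₁ e₂ k₁ k₂) e₁≢e₂
  ... | inj₁ o₁ | inj₂ k₂ = pendant e₁ e₂ o₁ k₂ λ e c →
    Sum.map (λ o → ≤1 e e₁ o o₁) (λ k → S≤1 e e₂ k k₂) (classify K S e c)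
  ... | inj₂ k₁ | inj₁ o₂ = pendant e₂ e₁ o₂ k₁ λ e c →
    Sum.map (λ o → ≤1 e e₂ o o₂) (λ k → S≤1 e e₁ k k₁) (classify K S e c)

  solve : ∀ K → Cuts K → Solution K
  solve K cuts = go K cuts (⊂-wellFounded K)
    where
    restrict : ∀ {K K′} → K′ ⊂ K → Cuts K → Cuts K′
    restrict (K′⊆K , _) cuts T T⊆K′ = cuts T (λ x∈ → K′⊆K (T⊆K′ x∈))

    go : ∀ K → Cuts K → Acc _⊂_ K → Solution K
    go K cuts (acc rec) with nonempty? K
    ... | no K≡∅  = solve-∅ K K≡∅
    ... | yes K≢∅ with minimal (leaf? K) K (K-leaf K K≢∅)
    ... | S , leaf@(S≢∅ , S⊆K , _) , S-min with exits K S leaf (cuts S S⊆K S≢∅)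
    ... | pendant d e o k cross with between⁻ o
    ...   | v , p , j , v∈S , p∈ =
      solve-pendant K S v p d e S⊆K v∈S (x∈∁p⇒x∉p p∈) (Joins-sym j) e≢d
        (widen k λ y∈ → x∉p⇒x∈∁p (proj₂ (∈∖⁻ K S y∈)))
        cross (go (K ∖ ⁅ v ⁆) (restrict K′⊂K cuts) (rec K′⊂K))
      where
      K′⊂K : K ∖ ⁅ v ⁆ ⊂ K
      K′⊂K = ∖-⊂ K ⁅ v ⁆ (S⊆K v∈S) (x∈⁅x⁆ v)

      widen : ∀ {e P Q R} → Between P Q e → Q ⊆ R → Between P R e
      widen b Q⊆R with between⁻ b
      ... | _ , _ , i , x∈ , y∈ = between⁺ i x∈ (Q⊆R y∈)

      e≢d : e ≢ d
      e≢d refl with between⁻ k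
      ... | x , y , i , x∈S , y∈ with Joins-unique i j
      ...   | inj₁ (_ , refl) = x∈∁p⇒x∉p p∈ (proj₁ (∈∖⁻ K S y∈))
      ...   | inj₂ (refl , _) = x∈∁p⇒x∉p p∈ (S⊆K x∈S)
    go K cuts (acc rec) | yes K≢∅ | S , leaf@(S≢∅ , S⊆K , _) , S-min | several d d′ o o′ d≢d′
      with between⁻ o | between⁻ o′
    ... | v , p , j , v∈S , p∈ | v′ , p′ , j′ , v′∈S , p′∈ =
      Step.solve-trail (go Step.K′ (restrict Step.K′⊂K cuts) (rec Step.K′⊂K))
      where
      S-conn : EdgeConnected₂ S
      S-conn = minimal-leaf-connected K leaf S-min

      module Step = SolveTrail K S v p v′ p′ d d′ S⊆K d≢d′ (x∈∁p⇒x∉p p∈) (x∈∁p⇒x∉p p′∈)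
        (Joins-sym j) (Joins-sym j′) S-conn (link S-conn v v′ v∈S v′∈S)

-- From walks to cuts

module Cutting (G : Digraph) where

  open Graph G

  -- The first step of the walk out of `T` is the crossing edge.
  walk-crosses : ∀ {X x y} T → WalkAvoiding G X x y → x ∈ T → y ∉ T →
                 ∃ λ e → ¬ X e × Between T (∁ T) e
  walk-crosses T here x∈T y∉T = contradiction x∈T y∉T
  walk-crosses T (forward e ¬Xe w) x∈T y∉T with head G e ∈? T
  ... | yes h∈T = walk-crosses T w h∈T y∉T
  ... | no h∉T  = e , ¬Xe , inj₁ (x∈T , x∉p⇒x∈∁p h∉T)
  walk-crosses T (backward e ¬Xe w) x∈T y∉T with tail G e ∈? T
  ... | yes t∈T = walk-crosses T w t∈T y∉T
  ... | no t∉T  = e , ¬Xe , inj₂ (x∈T , x∉p⇒x∈∁p t∉T)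

  -- Connectedness gives one crossing edge `e`; a walk that avoids `e` gives another.
  two-crossings : TwoEdgeConnected G → ∀ {x y} T → x ∈ T → y ∉ T → Two (Between T (∁ T))
  two-crossings (connected , robust) {x} {y} T x∈T y∉T with walk-crosses T (connected x y) x∈T y∉T
  ... | e , _ , e-cross with walk-crosses T (robust e x y) x∈T y∉T
  ...   | e′ , e′≢e , e′-cross = e′ , e , e′-cross , e-cross , e′≢e

-- The groups of order 2 and 3, and the theorem

open ℤ/1+ using (balanced⇒IsFlow)

laws₂ : ℤ/1+.Laws 1
laws₂ = from-yes (ℤ/1+.laws? 1)

laws₃ : ℤ/1+.Laws 2
laws₃ = from-yes (ℤ/1+.laws? 2)

nontrivial₂ : ∃ λ (a : Fin 2) → a ≢ zero
nontrivial₂ = suc zero , λ ()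

avoid-two₃ : ∀ (p q : Fin 3) → ∃ λ a → a ≢ p × a ≢ q
avoid-two₃ = from-yes
  (all? λ (p : Fin 3) → all? λ (q : Fin 3) → any? λ a → ¬? (a ≟ p) ×-dec ¬? (a ≟ q))

theorem2 : (G : Digraph) → TwoEdgeConnected G → (u : Fin (nV G)) →
    Σ (Fin (nE G) → Fin 2) λ f₂ → Σ (Fin (nE G) → Fin 3) λ f₃ →
    IsFlow G 2 f₂ × IsFlow G 3 f₃ ×
    (∀ e → (f₂ e ≢ zero) ⊎ (f₃ e ≢ zero)) ×
    (∀ e → Incident G e u → f₂ e ≡ zero)
theorem2 G 2ec u =
  f₂ , f₃ ,
  -- The induction asks nothing at `u`; conservation there follows from that at all other vertices.
  balanced⇒IsFlow 1 laws₂ G f₂ (Z₂.conservation G f₂ u λ v v≢u → balanced₂ v (other∈K v≢u)) ,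
  balanced⇒IsFlow 2 laws₃ G f₃ (Z₃.conservation G f₃ u λ v v≢u → balanced₃ v (other∈K v≢u)) ,
  nowhereZero ,
  λ { e (inj₁ refl) → vanishes e λ i → x∈∁p⇒x∉p (proj₁ i) (x∈⁅x⁆ u)
    ; e (inj₂ refl) → vanishes e λ i → x∈∁p⇒x∉p (proj₂ i) (x∈⁅x⁆ u) }
  where
  module Z₂ = Chains (ℤ/1+.isAbelianGroup 1 laws₂)
  module Z₃ = Chains (ℤ/1+.isAbelianGroup 2 laws₃)
  module Z₂×Z₃ = Induction G (ℤ/1+.isAbelianGroup 1 laws₂) (ℤ/1+.isAbelianGroup 2 laws₃)
                   nontrivial₂ avoid-two₃

  K : Subset (nV G)
  K = ∁ ⁅ u ⁆

  cuts : Z₂×Z₃.Cuts K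
  cuts T T⊆K (x , x∈T) =
    -- `u` is outside `T`, so it serves as the far end of the walks that cross the cut.
    Cutting.two-crossings G 2ec T x∈T λ u∈T → x∈∁p⇒x∉p (T⊆K u∈T) (x∈⁅x⁆ u)

  solution : Z₂×Z₃.Solution K
  solution = Z₂×Z₃.solve K cuts

  open Z₂×Z₃.Solution solution

  other∈K : ∀ {v} → v ≢ u → v ∈ K
  other∈K v≢u = x∉p⇒x∈∁p (x≢y⇒x∉⁅y⁆ v≢u)
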